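{- Let $A$ be an $n\times n$ alternating sign matrix. Then $\partial(\Phi(A))=\kappa(A)$.
   Context: An alternating sign matrix (ASM) is a square matrix with entries in $\{ -1,0,1\}$ such that in each row and column the nonzero entries alternate in sign and sum to $1$. An ASM with no negative entries is a permutation matrix, identified with the permutation $w$ such that the $1$'s are in positions $(i,w(i))$. Bumpless pipe dreams. Cells $(i,j)$ of the $n\times n$ grid: row $i$ from the top, column $j$ from the left. There are six tiles: downward elbow (a pipe joining the bottom and right edges), upward elbow (a pipe joining the left and top edges), crossing (one pipe joining left and right edges and one joining bottom and top edges), blank (no pipe), horizontal (left to right), vertical (bottom to top). A bumpless pipe dream (BPD) of size $n$ is a tiling of the grid by these tiles such that an edge shared by two cells is met by a pipe from both sides or from neither, every bottom and right boundary edge is met by a pipe, and no left or top boundary edge is met by a pipe. $\Phi$ is the bijection from $n\times n$ ASMs to BPDs of size $n$ for which $\Phi(A)$ has a downward elbow exactly where $A_{ij}=1$ and an upward elbow exactly where $A_{ij}=-1$. Explicitly, a pipe meets the right edge of cell $(i,j)$ iff $\sum_{k\le j}A_{ik}=1$, and meets the bottom edge of $(i,j)$ iff $\sum_{k\le i}A_{kj}=1$. Demazure product $\partial(\mathcal P)\in S_n$ of a BPD: label the bottom boundary edges $1,\dots,n$ from left to right and propagate labels along pipes north and east; at a crossing tile, of the two labels entering from the left and from below, the smaller leaves through the right edge and the larger through the top edge. $\partial(\mathcal P)(i)$ is the label arriving at the right boundary edge of row $i$. Inflation and key. The pivots of $(a,b)$ in $A$ are the positions $(i,j)\ne(a,b)$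 with $i\le a$, $j\le b$, $A_{ij}=1$, such that the only nonzero entries of $A$ in $[i,a]\times[j,b]$ are $A_{ij}$ and possibly $A_{ab}$. Suppose $A_{ab}=-1$ and let its pivots be $(i_1,j_1),\dots,(i_k,j_k)$ with $i_1<\cdots<i_k$ and $j_1>\cdots>j_k$. $A_{ab}$ is a removable $-1$ if there are no negative entries other than $A_{ab}$ in $\bigcup_{\ell=1}^{k-1}[i_\ell,a]\times[j_{\ell+1},b]$. Inflation of a removable $-1$ at $(a,b)$ sets the entries at $(a,b)$ and at all its pivots to $0$ and places $1$'s in positions $(i_1,j_2),(i_2,j_3),\dots,(i_{k-1},j_k)$; the result is an ASM with one fewer negative entry. The key $\kappa(A)$ is the permutation obtained by repeatedly applying inflation to the leftmost $-1$ in the topmost row containing negative entries (which is always removable), until no negative entries remain. -}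

module Defs where

open import Data.Bool.Base using (Bool; true; false; if_then_else_)
open import Data.Empty using (⊥-elim)
open import Data.Fin.Base using (Fin; zero; suc; toℕ; _<_; _≤_; punchOut)
open import Data.Fin.Properties using (_≟_; _≤?_; _<?_; all?; any?; punchOut-injective; injective⇒≤; <-cmp)
open import Data.Fin.Permutation using (Permutation′; permutation; _⟨$⟩ʳ_)
open import Data.Integer.Base as ℤ using (ℤ; 0ℤ; 1ℤ; -1ℤ)
import Data.Integer.Properties as ℤₚ
open import Data.Maybe.Base using (Maybe; just; nothing; is-just)
open import Data.Nat.Base as ℕ using (ℕ; zero; suc; z≤n; s≤s; z<s; s<s)
import Data.Nat.Properties as ℕₚ
open import Data.Nat.Induction using (Acc; acc; <-wellFounded)
open import Data.Product.Base using (∃; ∃₂; _×_; _,_; proj₁; proj₂)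
open import Data.Product.Properties using (≡-dec)
open import Data.Sum.Base using (_⊎_; inj₁; inj₂)
open import Data.Vec.Functional using (Vector; []; _∷_)
open import Algebra.Properties.Monoid.Sum ℤₚ.+-0-monoid using (sum)
open import Algebra.Properties.Monoid.Sum ℕₚ.+-0-monoid using () renaming (sum to sumℕ)
open import Function.Base using (_∘_)
open import Relation.Binary.Definitions using (DecidableEquality; tri<; tri≈; tri>)
open import Relation.Binary.PropositionalEquality using (_≡_; _≢_; refl; sym; trans; cong; subst)
open import Relation.Nullary using (¬_; Dec; yes; no; does; ¬?; _×-dec_; _⊎-dec_; _→-dec_)
open import Relation.Unary using (Decidable)

private variable
  n m k : ℕ

data Entry : Set where
  -𝟏 𝟎 𝟏 : Entry

value : Entry → ℤ
value -𝟏 = -1ℤ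
value 𝟎  = 0ℤ
value 𝟏  = 1ℤ

_≟ᴱ_ : DecidableEquality Entry
-𝟏 ≟ᴱ -𝟏 = yes refl
-𝟏 ≟ᴱ 𝟎  = no λ ()
-𝟏 ≟ᴱ 𝟏  = no λ ()
𝟎  ≟ᴱ -𝟏 = no λ ()
𝟎  ≟ᴱ 𝟎  = yes refl
𝟎  ≟ᴱ 𝟏  = no λ ()
𝟏  ≟ᴱ -𝟏 = no λ ()
𝟏  ≟ᴱ 𝟎  = no λ ()
𝟏  ≟ᴱ 𝟏  = yes refl

Matrix : ℕ → Set
Matrix n = Fin n → Fin n → Entry

-- Two nonzero entries with only zeros between them have opposite signs.
Alternating : Vector Entry n → Set
Alternating v = ∀ j k → j < k → v j ≢ 𝟎 → v k ≢ 𝟎 →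
  (∀ l → j < l → l < k → v l ≡ 𝟎) → v j ≢ v k

SumsToOne : Vector Entry n → Set
SumsToOne v = sum (value ∘ v) ≡ 1ℤ

record ASM (n : ℕ) : Set where
  field
    matrix          : Matrix n
    row-alternates  : ∀ i → Alternating (λ j → matrix i j)
    row-sum         : ∀ i → SumsToOne (λ j → matrix i j)
    col-alternates  : ∀ j → Alternating (λ i → matrix i j)
    col-sum         : ∀ j → SumsToOne (λ i → matrix i j)

open ASM public using (matrix)

permutationMatrix : Permutation′ n → Matrix n
permutationMatrix w i j = if does (w ⟨$⟩ʳ i ≟ j) then 𝟏 else 𝟎

data Tile : Set where
  down-elbow up-elbow crossing blank horizontal vertical : Tile

left right top bottom : Tile → Bool

left up-elbow   = true
left crossing   = true
left horizontal = true
left _          = false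

right down-elbow = true
right crossing   = true
right horizontal = true
right _          = false

top up-elbow = true
top crossing = true
top vertical = true
top _        = false

bottom down-elbow = true
bottom crossing   = true
bottom vertical   = true
bottom _          = false

record BPD (n : ℕ) : Set where
  field
    tile            : Fin n → Fin n → Tile
    horizontal-edge : ∀ i j j′ → toℕ j′ ≡ suc (toℕ j) → right (tile i j) ≡ left (tile i j′)
    vertical-edge   : ∀ i i′ j → toℕ i′ ≡ suc (toℕ i) → bottom (tile i j) ≡ top (tile i′ j)
    left-boundary   : ∀ i j → toℕ j ≡ 0 → left (tile i j) ≡ false
    top-boundary    : ∀ i j → toℕ i ≡ 0 → top (tile i j) ≡ false
    right-boundary  : ∀ i j → suc (toℕ j) ≡ n → right (tile i j) ≡ true
    bottom-boundary : ∀ i j → suc (toℕ i) ≡ n → bottom (tile i j) ≡ true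

-- partialSum v j = Σ_{k ≤ j} v k, the index j included.
partialSum : Vector Entry n → Fin n → ℤ
partialSum v zero    = value (v zero)
partialSum v (suc j) = value (v zero) ℤ.+ partialSum (v ∘ suc) j

partialSum-is-1 : Vector Entry n → Fin n → Bool
partialSum-is-1 v j = does (partialSum v j ℤₚ.≟ 1ℤ)

bit : Bool → ℤ
bit false = 0ℤ
bit true  = 1ℤ

data Step : Bool → Entry → Bool → Set where
  up   : Step false 𝟏 true
  down : Step true -𝟏 false
  stay : ∀ {c} → Step c 𝟎 c

-- Started at the partial sum c, the partial sums of v stay in {0, 1} and end at 1.
data Run : Bool → Vector Entry n → Set where
  nil  : {v : Vector Entry 0} → Run true v
  cons : ∀ {c d} {v : Vector Entry (suc n)} →
         Step c (v zero) d → Run d (v ∘ suc) → Run c v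

FirstNonzeroIsNot : Entry → Vector Entry n → Set
FirstNonzeroIsNot e v = ∀ j → (∀ l → l < j → v l ≡ 𝟎) → v j ≢ e

excluded : Bool → Entry
excluded false = -𝟏
excluded true  = 𝟏

excluded≢𝟎 : ∀ c → excluded c ≢ 𝟎
excluded≢𝟎 false ()
excluded≢𝟎 true  ()

step-bit : ∀ {c e d} → Step c e d → bit c ℤ.+ value e ≡ bit d
step-bit up              = refl
step-bit down            = refl
step-bit (stay {false})  = refl
step-bit (stay {true})   = refl

step-+ : ∀ {c e d} → Step c e d → ∀ x → bit c ℤ.+ (value e ℤ.+ x) ≡ bit d ℤ.+ x
step-+ {c} {e} s x = trans (sym (ℤₚ.+-assoc (bit c) (value e) x)) (cong (ℤ._+ x) (step-bit s))

alternating-tail : {v : Vector Entry (suc n)} → Alternating v → Alternating (v ∘ suc)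
alternating-tail {v = v} alt j k j<k p q z = alt (suc j) (suc k) (s<s j<k) p q between
  where
  between : ∀ l → suc j < l → l < suc k → v l ≡ 𝟎
  between (suc l) (s≤s x) (s≤s y) = z l x y

next-step : ∀ c (v : Vector Entry (suc n)) → Alternating v → FirstNonzeroIsNot (excluded c) v →
            ∃ λ d → Step c (v zero) d × FirstNonzeroIsNot (excluded d) (v ∘ suc)
next-step c v alt fn = go c (v zero) refl fn
  where
  after-zero : ∀ {e} → v zero ≡ 𝟎 → FirstNonzeroIsNot e v → FirstNonzeroIsNot e (v ∘ suc)
  after-zero z f j h = f (suc j) λ { zero _ → z ; (suc l) (s≤s p) → h l p }

  after-sign : ∀ d → v zero ≡ excluded d → FirstNonzeroIsNot (excluded d) (v ∘ suc)
  after-sign d z j h eq = alt zero (suc j) z<s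
    (λ w → excluded≢𝟎 d (trans (sym z) w)) (λ w → excluded≢𝟎 d (trans (sym eq) w))
    (λ { zero () ; (suc l) _ (s≤s p) → h l p }) (trans z (sym eq))

  go : ∀ c e → v zero ≡ e → FirstNonzeroIsNot (excluded c) v →
       ∃ λ d → Step c e d × FirstNonzeroIsNot (excluded d) (v ∘ suc)
  go c     𝟎  z f = c , stay , after-zero z f
  go false 𝟏  z f = true , up , after-sign true z
  go true  -𝟏 z f = false , down , after-sign false z
  go false -𝟏 z f = ⊥-elim (f zero (λ _ ()) z)
  go true  𝟏  z f = ⊥-elim (f zero (λ _ ()) z)

sum-bounds : ∀ c (v : Vector Entry n) → Alternating v → FirstNonzeroIsNot (excluded c) v →
             bit c ℤ.+ sum (value ∘ v) ≡ 0ℤ ⊎ bit c ℤ.+ sum (value ∘ v) ≡ 1ℤ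
sum-bounds {zero}  false v _ _ = inj₁ refl
sum-bounds {zero}  true  v _ _ = inj₂ refl
sum-bounds {suc _} c v alt fn with next-step c v alt fn
... | d , s , fn′ = subst (λ x → x ≡ 0ℤ ⊎ x ≡ 1ℤ) (sym (step-+ s (sum (value ∘ v ∘ suc))))
                          (sum-bounds d (v ∘ suc) (alternating-tail alt) fn′)

run-from : ∀ c (v : Vector Entry n) → Alternating v → FirstNonzeroIsNot (excluded c) v →
           bit c ℤ.+ sum (value ∘ v) ≡ 1ℤ → Run c v
run-from {zero}  true  v _ _ _ = nil
run-from {zero}  false v _ _ ()
run-from {suc _} c v alt fn Σ≡1 with next-step c v alt fn
... | d , s , fn′ = cons s (run-from d (v ∘ suc) (alternating-tail alt) fn′
                             (trans (sym (step-+ s (sum (value ∘ v ∘ suc)))) Σ≡1))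

run : (v : Vector Entry n) → Alternating v → SumsToOne v → Run false v
run v alt Σ≡1 = run-from false v alt starts (trans (ℤₚ.+-identityˡ _) Σ≡1)
  where
  starts : FirstNonzeroIsNot -𝟏 v
  starts j h v≡-𝟏 with sum-bounds true v alt not𝟏
    where
    not𝟏 : FirstNonzeroIsNot 𝟏 v
    not𝟏 j′ h′ v≡𝟏 with <-cmp j j′
    ... | tri< j<j′ _ _ with () ← trans (sym v≡-𝟏) (h′ j j<j′)
    ... | tri≈ _ refl _ with () ← trans (sym v≡-𝟏) v≡𝟏
    ... | tri> _ _ j′<j with () ← trans (sym v≡𝟏) (h j′ j′<j)
  ... | inj₁ e with () ← trans (sym e) (cong (ℤ._+_ 1ℤ) Σ≡1)
  ... | inj₂ e with () ← trans (sym e) (cong (ℤ._+_ 1ℤ) Σ≡1)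

reaches-1 : Bool → Vector Entry n → Fin n → Bool
reaches-1 c v j = does (bit c ℤ.+ partialSum v j ℤₚ.≟ 1ℤ)

is-1-bit : ∀ d → does (bit d ℤₚ.≟ 1ℤ) ≡ d
is-1-bit false = refl
is-1-bit true  = refl

reaches-1-zero : ∀ {c d} {v : Vector Entry (suc n)} → Step c (v zero) d → reaches-1 c v zero ≡ d
reaches-1-zero {d = d} s = trans (cong (λ x → does (x ℤₚ.≟ 1ℤ)) (step-bit s)) (is-1-bit d)

reaches-1-suc : ∀ {c d} {v : Vector Entry (suc n)} → Step c (v zero) d → ∀ j →
                reaches-1 c v (suc j) ≡ reaches-1 d (v ∘ suc) j
reaches-1-suc {v = v} s j = cong (λ x → does (x ℤₚ.≟ 1ℤ)) (step-+ s (partialSum (v ∘ suc) j))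

run-first : ∀ {c} {v : Vector Entry n} → Run c v → ∀ j → toℕ j ≡ 0 → Step c (v j) (reaches-1 c v j)
run-first {v = v} (cons s _) zero _ = subst (Step _ _) (sym (reaches-1-zero {v = v} s)) s

run-next : ∀ {c} {v : Vector Entry n} → Run c v → ∀ j j′ → toℕ j′ ≡ suc (toℕ j) →
           Step (reaches-1 c v j) (v j′) (reaches-1 c v j′)
run-next {v = v} (cons s r) zero (suc j′) eq
  rewrite reaches-1-zero {v = v} s | reaches-1-suc {v = v} s j′ = run-first r j′ (ℕₚ.suc-injective eq)
run-next {v = v} (cons s r) (suc j) (suc j′) eq
  rewrite reaches-1-suc {v = v} s j | reaches-1-suc {v = v} s j′ = run-next r j j′ (ℕₚ.suc-injective eq)

run-last : ∀ {c} {v : Vector Entry n} → Run c v → ∀ j → suc (toℕ j) ≡ n → reaches-1 c v j ≡ true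
run-last {v = v} (cons s nil)          zero    _  = reaches-1-zero {v = v} s
run-last {v = v} (cons s r@(cons _ _)) (suc j) eq =
  trans (reaches-1-suc {v = v} s j) (run-last r j (ℕₚ.suc-injective eq))

reaches-1-false : (v : Vector Entry n) → ∀ j → reaches-1 false v j ≡ partialSum-is-1 v j
reaches-1-false v j = cong (λ x → does (x ℤₚ.≟ 1ℤ)) (ℤₚ.+-identityˡ (partialSum v j))

module Profile (v : Vector Entry n) (alt : Alternating v) (Σ≡1 : SumsToOne v) where
  first : ∀ j → toℕ j ≡ 0 → Step false (v j) (partialSum-is-1 v j)
  first j eq = subst (Step _ _) (reaches-1-false v j) (run-first (run v alt Σ≡1) j eq)

  next : ∀ j j′ → toℕ j′ ≡ suc (toℕ j) → Step (partialSum-is-1 v j) (v j′) (partialSum-is-1 v j′)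
  next j j′ eq = subst (λ x → Step x _ _) (reaches-1-false v j)
    (subst (Step _ _) (reaches-1-false v j′) (run-next (run v alt Σ≡1) j j′ eq))

  last : ∀ j → suc (toℕ j) ≡ n → partialSum-is-1 v j ≡ true
  last j eq = trans (sym (reaches-1-false v j)) (run-last (run v alt Σ≡1) j eq)

  some : ∀ j → ∃ λ c → Step c (v j) (partialSum-is-1 v j)
  some j = go j (run v alt Σ≡1) (reaches-1-false v j)
    where
    go′ : ∀ {m c} {u : Vector Entry m} → ∀ j → Run c u → ∃ λ d → Step d (u j) (reaches-1 c u j)
    go′ {u = u} zero    (cons s _) = _ , subst (Step _ _) (sym (reaches-1-zero {v = u} s)) s
    go′ {u = u} (suc j) (cons s r) rewrite reaches-1-suc {v = u} s j = go′ j r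

    go : ∀ j → Run false v → reaches-1 false v j ≡ partialSum-is-1 v j →
         ∃ λ c → Step c (v j) (partialSum-is-1 v j)
    go j r eq with c , s ← go′ j r = c , subst (Step c _) eq s

-- The Booleans say whether a pipe meets the right, respectively bottom, edge
-- of the cell; they are forced when the entry is nonzero.
tile-of : Entry → Bool → Bool → Tile
tile-of 𝟏  _     _     = down-elbow
tile-of -𝟏 _     _     = up-elbow
tile-of 𝟎  true  true  = crossing
tile-of 𝟎  true  false = horizontal
tile-of 𝟎  false true  = vertical
tile-of 𝟎  false false = blank

Φ-tile : Matrix n → Fin n → Fin n → Tile
Φ-tile A i j = tile-of (A i j)
  (partialSum-is-1 (λ l → A i l) j)
  (partialSum-is-1 (λ l → A l j) i)

tile-left : ∀ {e c r} b → Step c e r → left (tile-of e r b) ≡ c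
tile-left b     up           = refl
tile-left b     down         = refl
tile-left true  (stay {true})  = refl
tile-left true  (stay {false}) = refl
tile-left false (stay {true})  = refl
tile-left false (stay {false}) = refl

tile-right : ∀ {e c r} b → Step c e r → right (tile-of e r b) ≡ r
tile-right b     up           = refl
tile-right b     down         = refl
tile-right true  (stay {true})  = refl
tile-right true  (stay {false}) = refl
tile-right false (stay {true})  = refl
tile-right false (stay {false}) = refl

tile-top : ∀ {e c b} r → Step c e b → top (tile-of e r b) ≡ c
tile-top r     up           = refl
tile-top r     down         = refl
tile-top true  (stay {true})  = refl
tile-top true  (stay {false}) = refl
tile-top false (stay {true})  = refl
tile-top false (stay {false}) = refl

tile-bottom : ∀ {e c b} r → Step c e b → bottom (tile-of e r b) ≡ b
tile-bottom r     up           = refl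
tile-bottom r     down         = refl
tile-bottom true  (stay {true})  = refl
tile-bottom true  (stay {false}) = refl
tile-bottom false (stay {true})  = refl
tile-bottom false (stay {false}) = refl

module _ (A : ASM n) where
  private
    module Row i = Profile (λ j → matrix A i j) (ASM.row-alternates A i) (ASM.row-sum A i)
    module Col j = Profile (λ i → matrix A i j) (ASM.col-alternates A j) (ASM.col-sum A j)

  Φ-right : ∀ i j → right (Φ-tile (matrix A) i j) ≡ partialSum-is-1 (λ l → matrix A i l) j
  Φ-right i j = tile-right _ (proj₂ (Row.some i j))

  Φ-bottom : ∀ i j → bottom (Φ-tile (matrix A) i j) ≡ partialSum-is-1 (λ l → matrix A l j) i
  Φ-bottom i j = tile-bottom _ (proj₂ (Col.some j i))

  Φ : BPD n
  Φ = record
    { tile            = Φ-tile (matrix A)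
    ; horizontal-edge = λ i j j′ eq → trans (Φ-right i j) (sym (tile-left _ (Row.next i j j′ eq)))
    ; vertical-edge   = λ i i′ j eq → trans (Φ-bottom i j) (sym (tile-top _ (Col.next j i i′ eq)))
    ; left-boundary   = λ i j eq → tile-left _ (Row.first i j eq)
    ; top-boundary    = λ i j eq → tile-top _ (Col.first j i eq)
    ; right-boundary  = λ i j eq → trans (Φ-right i j) (Row.last i j eq)
    ; bottom-boundary = λ i j eq → trans (Φ-bottom i j) (Col.last j i eq)
    }

-- The label on an edge, `nothing` when no pipe meets it.  The label of the
-- j-th bottom boundary edge is j itself.
Label : ℕ → Set
Label n = Maybe (Fin n)

-- Takes the labels on the left and bottom edges to those on the right and top
-- edges.  The last clause is never reached in a BPD.
propagate : Tile → Label n → Label n → Label n × Label n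
propagate down-elbow l b = b , nothing
propagate up-elbow   l b = nothing , l
propagate blank      l b = nothing , nothing
propagate horizontal l b = l , nothing
propagate vertical   l b = nothing , b
propagate crossing (just x) (just y) =
  if does (x ≤? y) then (just x , just y) else (just y , just x)
propagate crossing _ _ = nothing , nothing

-- One row, from left to right: the label leaving on the right and the labels
-- on the top edges.
propagate-row : (Fin m → Tile) → Label n → (Fin m → Label n) → Label n × (Fin m → Label n)
propagate-row {zero}  t l b = l , b
propagate-row {suc m} t l b =
  let r , u  = propagate (t zero) l (b zero)
      e , us = propagate-row (t ∘ suc) r (b ∘ suc)
  in  e , u ∷ us

-- All rows, from the lowest to the topmost: the labels leaving on the right
-- of each row and the labels on the top edges of the topmost row.
propagate-rows : (Fin k → Fin m → Tile) → (Fin m → Label n) → (Fin k → Label n) × (Fin m → Label n)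
propagate-rows {zero}  t b = [] , b
propagate-rows {suc k} t b =
  let es , b′ = propagate-rows (t ∘ suc) b
      e  , us = propagate-row (t zero) nothing b′
  in  e ∷ es , us

exit-label : BPD n → Fin n → Label n
exit-label P = proj₁ (propagate-rows (BPD.tile P) just)

-- Consecutive tiles agree on their shared edge, and the outer edges are c and d.
data Chain (start end : Tile → Bool) : Bool → (Fin m → Tile) → Bool → Set where
  nil  : ∀ {c} {t : Fin 0 → Tile} → Chain start end c t c
  cons : ∀ {c d} {t : Fin (suc m) → Tile} → start (t zero) ≡ c →
         Chain start end (end (t zero)) (t ∘ suc) d → Chain start end c t d

chain : ∀ {start end : Tile → Bool} {c d} (t : Fin (suc m) → Tile) →
        (∀ j j′ → toℕ j′ ≡ suc (toℕ j) → end (t j) ≡ start (t j′)) →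
        (∀ j → toℕ j ≡ 0 → start (t j) ≡ c) →
        (∀ j → suc (toℕ j) ≡ suc m → end (t j) ≡ d) →
        Chain start end c t d
chain {zero}  {start} {end} t adj first last =
  cons (first zero refl) (subst (Chain start end _ _) (last zero refl) nil)
chain {suc m} {start} {end} t adj first last =
  cons (first zero refl) (chain (t ∘ suc) (λ j j′ eq → adj (suc j) (suc j′) (cong suc eq))
    (λ { zero _ → sym (adj zero (suc zero) refl) ; (suc _) () }) (λ j eq → last (suc j) (cong suc eq)))

Chained : BPD n → Set
Chained P = (∀ i → Chain left right false (BPD.tile P i) true) ×
            (∀ j → Chain top bottom false (λ i → BPD.tile P i j) true)

chained : (P : BPD n) → Chained P
chained {zero}  P = (λ ()) , (λ ())
chained {suc n} P =
  (λ i → chain (tile i) (horizontal-edge i) (left-boundary i) (right-boundary i)) ,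
  (λ j → chain (λ i → tile i j) (λ i i′ → vertical-edge i i′ j)
               (λ i → top-boundary i j) (λ i → bottom-boundary i j))
  where open BPD P

propagate-defined : ∀ t {l b : Label n} → is-just l ≡ left t → is-just b ≡ bottom t →
  is-just (proj₁ (propagate t l b)) ≡ right t × is-just (proj₂ (propagate t l b)) ≡ top t
propagate-defined down-elbow p q = q , refl
propagate-defined up-elbow   p q = refl , p
propagate-defined blank      p q = refl , refl
propagate-defined horizontal p q = p , refl
propagate-defined vertical   p q = refl , q
propagate-defined crossing {just x} {just y} p q with does (x ≤? y)
... | true  = refl , refl
... | false = refl , refl

propagate-keeps : ∀ t {l b : Label n} → is-just l ≡ left t → is-just b ≡ bottom t → ∀ x →
  l ≡ just x ⊎ b ≡ just x →
  proj₁ (propagate t l b) ≡ just x ⊎ proj₂ (propagate t l b) ≡ just x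
propagate-keeps down-elbow p q x (inj₁ refl) with () ← p
propagate-keeps down-elbow p q x (inj₂ e) = inj₁ e
propagate-keeps up-elbow   p q x (inj₁ e) = inj₂ e
propagate-keeps up-elbow   p q x (inj₂ refl) with () ← q
propagate-keeps blank      p q x (inj₁ refl) with () ← p
propagate-keeps blank      p q x (inj₂ refl) with () ← q
propagate-keeps horizontal p q x (inj₁ e) = inj₁ e
propagate-keeps horizontal p q x (inj₂ refl) with () ← q
propagate-keeps vertical   p q x (inj₁ refl) with () ← p
propagate-keeps vertical   p q x (inj₂ e) = inj₂ e
propagate-keeps crossing {just y} {just z} p q x h with does (y ≤? z) | h
... | true  | h′      = h′
... | false | inj₁ e = inj₂ e
... | false | inj₂ e = inj₁ e

row-defined : ∀ {c d} {t : Fin m → Tile} → Chain left right c t d →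
  {l : Label n} {b : Fin m → Label n} → is-just l ≡ c → (∀ j → is-just (b j) ≡ bottom (t j)) →
  is-just (proj₁ (propagate-row t l b)) ≡ d ×
  (∀ j → is-just (proj₂ (propagate-row t l b) j) ≡ top (t j))
row-defined nil p q = p , λ ()
row-defined {t = t} (cons s ch) p q
  with r , u ← propagate-defined (t zero) (trans p (sym s)) (q zero)
  with e , us ← row-defined ch r (q ∘ suc)
  = e , λ { zero → u ; (suc j) → us j }

row-keeps : ∀ {c d} {t : Fin m → Tile} → Chain left right c t d →
  {l : Label n} {b : Fin m → Label n} → is-just l ≡ c → (∀ j → is-just (b j) ≡ bottom (t j)) →
  ∀ x → l ≡ just x ⊎ (∃ λ j → b j ≡ just x) →
  proj₁ (propagate-row t l b) ≡ just x ⊎ (∃ λ j → proj₂ (propagate-row t l b) j ≡ just x)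
row-keeps nil p q x (inj₁ e) = inj₁ e
row-keeps {t = t} (cons s ch) {l} {b} p q x h = go h
  where
  p′ = trans p (sym s)
  r  = proj₁ (propagate-defined (t zero) p′ (q zero))

  Goal : Set
  Goal = proj₁ (propagate-row t l b) ≡ just x ⊎ (∃ λ j → proj₂ (propagate-row t l b) j ≡ just x)

  later : proj₁ (propagate (t zero) l (b zero)) ≡ just x ⊎ (∃ λ j → b (suc j) ≡ just x) → Goal
  later h′ with row-keeps ch r (q ∘ suc) x h′
  ... | inj₁ e       = inj₁ e
  ... | inj₂ (j , e) = inj₂ (suc j , e)

  here : l ≡ just x ⊎ b zero ≡ just x → Goal
  here h′ with propagate-keeps (t zero) p′ (q zero) x h′
  ... | inj₁ e = later (inj₁ e)
  ... | inj₂ e = inj₂ (zero , e)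

  go : l ≡ just x ⊎ (∃ λ j → b j ≡ just x) → Goal
  go (inj₁ e)           = here (inj₁ e)
  go (inj₂ (zero , e))  = here (inj₂ e)
  go (inj₂ (suc j , e)) = later (inj₂ (j , e))

uncons-start : ∀ {c d} {start end : Tile → Bool} {t : Fin (suc m) → Tile} →
               Chain start end c t d → start (t zero) ≡ c
uncons-start (cons s _) = s

uncons-tail : ∀ {c d} {start end : Tile → Bool} {t : Fin (suc m) → Tile} →
              Chain start end c t d → Chain start end (end (t zero)) (t ∘ suc) d
uncons-tail (cons _ ch) = ch

nil-≡ : ∀ {c d} {start end : Tile → Bool} {t : Fin 0 → Tile} → Chain start end c t d → d ≡ c
nil-≡ nil = refl

rows-defined : {t : Fin k → Fin m → Tile} {c : Fin m → Bool} →
  (∀ i → Chain left right false (t i) true) → (∀ j → Chain top bottom (c j) (λ i → t i j) true) →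
  {b : Fin m → Label n} → (∀ j → is-just (b j) ≡ true) →
  (∀ i → is-just (proj₁ (propagate-rows t b) i) ≡ true) ×
  (∀ j → is-just (proj₂ (propagate-rows t b) j) ≡ c j)
rows-defined {zero}  rc cc q = (λ ()) , λ j → trans (q j) (nil-≡ (cc j))
rows-defined {suc k} rc cc q
  with es , b′ ← rows-defined (rc ∘ suc) (uncons-tail ∘ cc) q
  with e , us ← row-defined (rc zero) refl b′
  = (λ { zero → e ; (suc i) → es i }) , λ j → trans (us j) (uncons-start (cc j))

rows-keep : {t : Fin k → Fin m → Tile} {c : Fin m → Bool} →
  (∀ i → Chain left right false (t i) true) → (∀ j → Chain top bottom (c j) (λ i → t i j) true) →
  {b : Fin m → Label n} → (∀ j → is-just (b j) ≡ true) → ∀ x → (∃ λ j → b j ≡ just x) →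
  (∃ λ i → proj₁ (propagate-rows t b) i ≡ just x) ⊎ (∃ λ j → proj₂ (propagate-rows t b) j ≡ just x)
rows-keep {zero}  rc cc q x h = inj₂ h
rows-keep {suc k} rc cc q x h with rows-keep (rc ∘ suc) (uncons-tail ∘ cc) q x h
... | inj₁ (i , e) = inj₁ (suc i , e)
... | inj₂ h′ with row-keeps (rc zero) refl (proj₂ (rows-defined (rc ∘ suc) (uncons-tail ∘ cc) q)) x (inj₂ h′)
...   | inj₁ e = inj₁ (zero , e)
...   | inj₂ w = inj₂ w

is-just⇒∃ : ∀ {A : Set} (x : Maybe A) → is-just x ≡ true → ∃ λ a → x ≡ just a
is-just⇒∃ (just a) _ = a , refl

surjective⇒permutation : (f : Fin n → Fin n) → (∀ x → ∃ λ i → f i ≡ x) → Permutation′ n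
surjective⇒permutation {n} f surj = permutation f g f∘g (g∘f _ refl)
  where
  g : Fin n → Fin n
  g x = proj₁ (surj x)

  f∘g : ∀ x → f (g x) ≡ x
  f∘g x = proj₂ (surj x)

  g-injective : ∀ {x y} → g x ≡ g y → x ≡ y
  g-injective {x} {y} e = trans (sym (f∘g x)) (trans (cong f e) (f∘g y))

  g∘f : ∀ m → n ≡ m → ∀ i → g (f i) ≡ i
  g∘f zero    refl ()
  g∘f (suc m) refl i with any? (λ x → i ≟ g x)
  ... | yes (x , refl) = cong g (f∘g x)
  ... | no missed = ⊥-elim (ℕₚ.1+n≰n (injective⇒≤ {f = λ x → punchOut {i = i} (λ e → missed (x , e))}
                      (λ {x} {y} e → g-injective (punchOut-injective (λ e′ → missed (x , e′)) (λ e′ → missed (y , e′)) e))))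

exit-label-defined : (P : BPD n) → ∀ i → ∃ λ x → exit-label P i ≡ just x
exit-label-defined P i =
  is-just⇒∃ _ (proj₁ (rows-defined (proj₁ (chained P)) (proj₂ (chained P)) (λ _ → refl)) i)

exit-label-surjective : (P : BPD n) → ∀ x → ∃ λ i → proj₁ (exit-label-defined P i) ≡ x
exit-label-surjective P x
  with rows-keep (proj₁ (chained P)) (proj₂ (chained P)) (λ _ → refl) x (x , refl)
... | inj₁ (i , e) = i , just-injective (trans (sym (proj₂ (exit-label-defined P i))) e)
  where
  just-injective : ∀ {A : Set} {a b : A} → just a ≡ just b → a ≡ b
  just-injective refl = refl
... | inj₂ (j , e)
  with () ← trans (sym (cong is-just e)) (proj₂ (rows-defined (proj₁ (chained P)) (proj₂ (chained P)) (λ _ → refl)) j)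

∂ : BPD n → Permutation′ n
∂ P = surjective⇒permutation (λ i → proj₁ (exit-label-defined P i)) (exit-label-surjective P)

∂-exit-label : (P : BPD n) → ∀ i → exit-label P i ≡ just (∂ P ⟨$⟩ʳ i)
∂-exit-label P i = proj₂ (exit-label-defined P i)

_≟₂_ : DecidableEquality (Fin n × Fin n)
_≟₂_ = ≡-dec _≟_ _≟_

module _ (A : Matrix n) (a b : Fin n) where

  IsPivot : Fin n → Fin n → Set
  IsPivot i j = (i , j) ≢ (a , b) × i ≤ a × j ≤ b × A i j ≡ 𝟏 ×
    (∀ x y → i ≤ x → x ≤ a → j ≤ y → y ≤ b → A x y ≢ 𝟎 →
      (x , y) ≡ (i , j) ⊎ (x , y) ≡ (a , b))

  -- (i , j) and (i′ , j′) are (i_ℓ , j_ℓ) and (i_{ℓ+1} , j_{ℓ+1}) in the list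
  -- of pivots sorted by increasing row.  No two pivots of a matrix lie weakly
  -- northwest of one another, so the columns then decrease.
  ConsecutivePivots : Fin n → Fin n → Fin n → Fin n → Set
  ConsecutivePivots i j i′ j′ = IsPivot i j × IsPivot i′ j′ × i < i′ ×
    (∀ x y → IsPivot x y → ¬ (i < x × x < i′))

  Removable : Set
  Removable = A a b ≡ -𝟏 ×
    (∀ i j i′ j′ → ConsecutivePivots i j i′ j′ →
      ∀ x y → i ≤ x → x ≤ a → j′ ≤ y → y ≤ b → A x y ≡ -𝟏 → (x , y) ≡ (a , b))

  -- (i , j) is one of (i_1 , j_2), …, (i_{k-1} , j_k).
  IsCorner : Fin n → Fin n → Set
  IsCorner i j = ∃₂ λ j₀ i′ → ConsecutivePivots i j₀ i′ j

  isPivot? : ∀ i j → Dec (IsPivot i j)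
  isPivot? i j = ¬? ((i , j) ≟₂ (a , b)) ×-dec i ≤? a ×-dec j ≤? b ×-dec A i j ≟ᴱ 𝟏 ×-dec
    all? λ x → all? λ y → i ≤? x →-dec (x ≤? a →-dec (j ≤? y →-dec (y ≤? b →-dec
      (¬? (A x y ≟ᴱ 𝟎) →-dec ((x , y) ≟₂ (i , j) ⊎-dec (x , y) ≟₂ (a , b))))))

  consecutivePivots? : ∀ i j i′ j′ → Dec (ConsecutivePivots i j i′ j′)
  consecutivePivots? i j i′ j′ = isPivot? i j ×-dec isPivot? i′ j′ ×-dec i <? i′ ×-dec
    all? λ x → all? λ y → isPivot? x y →-dec ¬? (i <? x ×-dec x <? i′)

  isCorner? : ∀ i j → Dec (IsCorner i j)
  isCorner? i j = any? λ j₀ → any? λ i′ → consecutivePivots? i j₀ i′ j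

  inflate : .Removable → Matrix n
  inflate _ i j =
    if does (isCorner? i j) then 𝟏 else
    if does ((i , j) ≟₂ (a , b) ⊎-dec isPivot? i j) then 𝟎 else
    A i j

-- (a , b) is the leftmost -1 in the topmost row containing negative entries.
FirstNegative : Matrix n → Fin n → Fin n → Set
FirstNegative A a b = A a b ≡ -𝟏 ×
  (∀ i j → i < a → A i j ≢ -𝟏) × (∀ j → j < b → A a j ≢ -𝟏)

NonNegative : Matrix n → Set
NonNegative A = ∀ i j → A i j ≢ -𝟏

least : {P : Fin n → Set} → Decidable P →
        (∀ i → ¬ P i) ⊎ (∃ λ i → P i × (∀ j → j < i → ¬ P j))
least {zero}  P? = inj₁ λ ()
least {suc n} P? with P? zero
... | yes p = inj₂ (zero , p , λ _ ())
... | no ¬p with least (P? ∘ suc)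
...   | inj₁ none          = inj₁ λ { zero → ¬p ; (suc i) → none i }
...   | inj₂ (i , p , min) = inj₂ (suc i , p , λ { zero _ → ¬p ; (suc j) (s≤s j<i) → min j j<i })

first-negative : (A : Matrix n) → NonNegative A ⊎ ∃₂ (FirstNegative A)
first-negative A with least (λ i → any? λ j → A i j ≟ᴱ -𝟏)
... | inj₁ none = inj₁ λ i j e → none i (j , e)
... | inj₂ (a , (b₀ , e₀) , above) with least (λ j → A a j ≟ᴱ -𝟏)
...   | inj₁ none            = ⊥-elim (none b₀ e₀)
...   | inj₂ (b , e , before) = inj₂ (a , b , e , (λ i j i<a e′ → above i i<a (j , e′)) , before)

first-removable : (A : Matrix n) (a b : Fin n) → FirstNegative A a b → Removable A a b
first-removable A a b (e , above , before) = e , λ i j i′ j′ _ x y _ x≤a _ y≤b Axy≡-𝟏 →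
  only x y x≤a y≤b Axy≡-𝟏
  where
  only : ∀ x y → x ≤ a → y ≤ b → A x y ≡ -𝟏 → (x , y) ≡ (a , b)
  only x y x≤a y≤b e′ with <-cmp x a
  ... | tri< x<a _ _ = ⊥-elim (above x y x<a e′)
  ... | tri> _ _ a<x = ⊥-elim (ℕₚ.<⇒≱ a<x x≤a)
  ... | tri≈ _ refl _ with <-cmp y b
  ...   | tri< y<b _ _  = ⊥-elim (before y y<b e′)
  ...   | tri> _ _ b<y  = ⊥-elim (ℕₚ.<⇒≱ b<y y≤b)
  ...   | tri≈ _ refl _ = refl

negative : Entry → ℕ
negative -𝟏 = 1
negative 𝟎  = 0
negative 𝟏  = 0

negatives : Matrix n → ℕ
negatives A = sumℕ λ i → sumℕ λ j → negative (A i j)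

sum-mono : {f g : Fin n → ℕ} → (∀ i → f i ℕ.≤ g i) → sumℕ f ℕ.≤ sumℕ g
sum-mono {zero}  le = z≤n
sum-mono {suc n} le = ℕₚ.+-mono-≤ (le zero) (sum-mono (le ∘ suc))

sum-mono-< : {f g : Fin n → ℕ} → (∀ i → f i ℕ.≤ g i) → ∀ i → f i ℕ.< g i → sumℕ f ℕ.< sumℕ g
sum-mono-< le zero    lt = ℕₚ.+-mono-<-≤ lt (sum-mono (le ∘ suc))
sum-mono-< le (suc i) lt = ℕₚ.+-mono-≤-< (le zero) (sum-mono-< (le ∘ suc) i lt)

inflate-negatives : (A : Matrix n) (a b : Fin n) (r : Removable A a b) →
                    negatives (inflate A a b r) ℕ.< negatives A
inflate-negatives A a b r =
  sum-mono-< (λ i → sum-mono (le i)) a (sum-mono-< (le a) b lt)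
  where
  le : ∀ i j → negative (inflate A a b r i j) ℕ.≤ negative (A i j)
  le i j with does (isCorner? A a b i j)
  ... | true = z≤n
  ... | false with does ((i , j) ≟₂ (a , b) ⊎-dec isPivot? A a b i j)
  ...   | true  = z≤n
  ...   | false = ℕₚ.≤-refl

  lt : negative (inflate A a b r a b) ℕ.< negative (A a b)
  lt rewrite proj₁ r with does (isCorner? A a b a b)
  ... | true = z<s
  ... | false with (a , b) ≟₂ (a , b)
  ...   | yes _ = z<s
  ...   | no ¬e = ⊥-elim (¬e refl)

inflate-all : (A : Matrix n) → Acc ℕ._<_ (negatives A) → Matrix n
inflate-all A (acc rec) with first-negative A
... | inj₁ _           = A
... | inj₂ (a , b , f) = inflate-all (inflate A a b r) (rec (inflate-negatives A a b r))
  where r = first-removable A a b f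

-- The key, as an alternating sign matrix with no negative entries, i.e. as the
-- permutation matrix with 1's at (i , w i).
κ : ASM n → Matrix n
κ A = inflate-all (matrix A) (<-wellFounded _)

{-# OPTIONS --safe #-}

-- A single inflation changes no exit label, because the two labelled grids can
-- be compared row by row, upwards from the removed -1 at (a , b).  On the line
-- above each row, either the labels agree, or inflation leaves in some column
-- q < b the pipe which in A runs in column b: the labels of A then arise from
-- those of the inflation by an extra row with an elbow up from column q to the
-- right and one from the left into column b.  This extra row moves up through a
-- row of the matrix by the Yang-Baxter equation; at a pivot (i , p) the inflated
-- matrix has its 1 in column q instead, and q becomes p.  The pivot in column b
-- cancels the extra row.  Once no negative entries remain, each crossing has the
-- smaller label on the left, so that every pipe goes straight and turns once.

module Submission where

open import Data.Bool.Base using (Bool; true; false; if_then_else_)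
open import Data.Empty using (⊥-elim)
open import Data.Fin.Base using (Fin; zero; suc; _<_; _≤_)
open import Data.Fin.Permutation using (_⟨$⟩ʳ_)
open import Data.Fin.Properties using (_≟_; _≤?_; ≤-total; suc-injective)
import Data.Fin.Properties as Finₚ
open import Data.Maybe.Base using (just; nothing; is-just)
open import Data.Maybe.Properties using (just-injective)
open import Data.Nat.Base as ℕ using (ℕ; zero; suc; z≤n; s≤s; z<s; s<s)
open import Data.Nat.Induction using (Acc; acc; <-wellFounded)
import Data.Nat.Properties as ℕₚ
open import Data.Product.Base using (∃; ∃₂; _×_; _,_; proj₁; proj₂)
open import Data.Sum.Base using (_⊎_; inj₁; inj₂) renaming (map to map⊎)
open import Data.Vec.Functional using (Vector; []; _∷_)
open import Function.Base using (_∘_; case_of_)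
open import Relation.Binary.Definitions using (Tri; tri<; tri≈; tri>)
open import Relation.Binary.PropositionalEquality
  using (_≡_; _≢_; _≗_; refl; sym; trans; cong; cong₂; subst)
open import Relation.Nullary using (¬_; yes; no; does; _⊎-dec_)
open import Relation.Nullary.Decidable using (dec-true; dec-false)
open import Defs

private variable
  n m k : ℕ

-- Labelling by matrix entries instead of tiles

cross : Label n → Label n → Label n × Label n
cross nothing  b        = nothing , b
cross (just x) nothing  = just x , nothing
cross (just x) (just y) = propagate crossing (just x) (just y)

-- The tile of a zero entry is read off from the labels present rather than from partial sums, so
-- that rows which do not sum to 1, such as a `dipole` with q < b, can be labelled too.
cell : Entry → Label n → Label n → Label n × Label n
cell 𝟏  l b = b , nothing
cell -𝟏 l b = nothing , l
cell 𝟎  l b = cross l b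

row : Vector Entry m → Label n → Vector (Label n) m → Label n × Vector (Label n) m
row {zero}  v l b = l , b
row {suc m} v l b =
  let r , u  = cell (v zero) l (b zero)
      e , us = row (v ∘ suc) r (b ∘ suc)
  in  e , u ∷ us

rows : (Fin k → Vector Entry m) → Vector (Label n) m → Vector (Label n) k × Vector (Label n) m
rows {zero}  A b = [] , b
rows {suc k} A b =
  let es , b′ = rows (A ∘ suc) b
      e  , us = row (A zero) nothing b′
  in  e ∷ es , us

infix 4 _≈_
_≈_ : {X : Set} → X × Vector (Label n) m → X × Vector (Label n) m → Set
(e , u) ≈ (e′ , u′) = e ≡ e′ × u ≗ u′

∷-≗ : {X : Set} {x x′ : X} {u u′ : Vector X m} → x ≡ x′ → u ≗ u′ → (x ∷ u) ≗ (x′ ∷ u′)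
∷-≗ p q zero    = p
∷-≗ p q (suc j) = q j

row-cong : {v v′ : Vector Entry m} {l l′ : Label n} {b b′ : Vector (Label n) m} →
           v ≗ v′ → l ≡ l′ → b ≗ b′ → row v l b ≈ row v′ l′ b′
row-cong {zero}  p q r = q , r
row-cong {suc m} {v = v} {v′} {l} {l′} {b} {b′} p q r
  with cell (v zero) l (b zero) | cell (v′ zero) l′ (b′ zero)
     -- The outputs of the two first cells are abstracted together with their equality, so that the
     -- rest recurses from one common label.
     | cong₂ (λ e → λ (x , y) → cell e x y) (p zero) (cong₂ _,_ q (r zero))
... | _ | _ | refl with e , us ← row-cong (p ∘ suc) refl (r ∘ suc) = e , ∷-≗ refl us

rows-cong : {A A′ : Fin k → Vector Entry m} {b : Vector (Label n) m} →
            (∀ i → A i ≗ A′ i) → proj₁ (rows A b) ≗ proj₁ (rows A′ b) × proj₂ (rows A b) ≗ proj₂ (rows A′ b)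
rows-cong {zero}  p = (λ ()) , λ _ → refl
rows-cong {suc k} p
  with es , us ← rows-cong (p ∘ suc)
  with e , vs ← row-cong (p zero) refl us
  = ∷-≗ e es , vs

-- Rows of special shape

zeros : Vector Entry m
zeros _ = 𝟎

unit : Fin m → Vector Entry m
unit p j = if does (p ≟ j) then 𝟏 else 𝟎

-- What a `dipole` leaves to the right of its column q: a pipe arriving on the left edge runs along
-- the row and turns up in column b.
ray : Fin m → Vector Entry m
ray b j = if does (b ≟ j) then -𝟏 else 𝟎

-- For q < b, the entries of a row in which a pipe enters from below in column q
-- and leaves upwards in column b.
dipole : Fin m → Fin m → Vector Entry m
dipole q b j = if does (q ≟ j) then 𝟏 else ray b j

unit-at : (p : Fin m) → unit p p ≡ 𝟏
unit-at p with p ≟ p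
... | yes _ = refl
... | no ¬e = ⊥-elim (¬e refl)

unit-off : {p j : Fin m} → j ≢ p → unit p j ≡ 𝟎
unit-off {p = p} {j} j≢p with p ≟ j
... | yes e = ⊥-elim (j≢p (sym e))
... | no _  = refl

row-zeros : (b : Vector (Label n) m) → row zeros nothing b ≈ (nothing , b)
row-zeros {m = zero}  b = refl , λ _ → refl
row-zeros {m = suc m} b with e , us ← row-zeros (b ∘ suc) = e , λ { zero → refl ; (suc j) → us j }

-- Sorting labels and the Yang-Baxter equation

cross-≤ : {x y : Fin n} → x ≤ y → cross (just x) (just y) ≡ (just x , just y)
cross-≤ {x = x} {y} x≤y rewrite dec-true (x ≤? y) x≤y = refl

-- Equal labels are left in place by `cross`, and then the two orders coincide.
cross-≥ : {x y : Fin n} → y ≤ x → cross (just x) (just y) ≡ (just y , just x)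
cross-≥ {x = x} {y} y≤x with x ≟ y
... | yes refl = cross-≤ y≤x
... | no x≢y rewrite dec-false (x ≤? y) (λ x≤y → x≢y (Finₚ.≤-antisym x≤y y≤x)) = refl

cross-nothing : (l : Label n) → cross l nothing ≡ (l , nothing)
cross-nothing nothing  = refl
cross-nothing (just _) = refl

-- Three present labels get sorted on both sides: the smallest leaves as `b₁`, the middle one as
-- `t₁`, the largest as `o`. If a label is absent, at most one pair is compared, and it is the same
-- on both sides.
yang-baxter : (h x v : Label n) →
  let x₁ , v₁ = cross x v
      h₁ , o  = cross h v₁
      b  , t  = cross h x
      b₁ , w  = cross b v
      t₁ , o′ = cross t w
  in cross h₁ x₁ ≡ (b₁ , t₁) × o ≡ o′
yang-baxter nothing  x        v        = refl , refl
yang-baxter (just h) nothing  nothing  = refl , refl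
yang-baxter (just h) nothing  (just v) = cross-nothing _ , refl
yang-baxter (just h) (just x) nothing
  rewrite cross-nothing (proj₁ (cross (just h) (just x))) | cross-nothing (proj₂ (cross (just h) (just x))) = refl , refl
yang-baxter (just h) (just x) (just v) with ≤-total h x | ≤-total x v | ≤-total h v
... | inj₁ hx | inj₁ xv | _       rewrite cross-≤ xv | cross-≤ (Finₚ.≤-trans hx xv) | cross-≤ hx | cross-≤ (Finₚ.≤-trans hx xv) | cross-≤ xv = refl , refl
... | inj₁ hx | inj₂ vx | inj₁ hv rewrite cross-≤ hx | cross-≥ vx | cross-≤ hv | cross-≤ hx | cross-≤ hv | cross-≥ vx = refl , refl
... | inj₁ hx | inj₂ vx | inj₂ vh rewrite cross-≤ hx | cross-≥ vx | cross-≥ vh | cross-≤ hx | cross-≥ vh | cross-≥ hx = refl , refl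
... | inj₂ xh | inj₁ xv | inj₁ hv rewrite cross-≥ xh | cross-≤ xv | cross-≤ hv | cross-≥ xh = refl , refl
... | inj₂ xh | inj₁ xv | inj₂ vh rewrite cross-≥ xh | cross-≤ xv | cross-≥ vh | cross-≥ xv = refl , refl
... | inj₂ xh | inj₂ vx | _       rewrite cross-≥ vx | cross-≥ xh | cross-≥ vx | cross-≥ xh = refl , refl

-- Moving the extra row through a row of the matrix

-- On the left, the row r lies above s; on the right, s′ lies above r′.  The
-- labels on the left edges of s, r, r′ and s′ are x, h, b and t.
Exchange : (s r r′ s′ : Vector Entry m) (x h b t : Label n) (v : Vector (Label n) m) → Set
Exchange s r r′ s′ x h b t v =
  row r h (proj₂ (row s x v)) ≈
  (proj₁ (row r′ b v) , proj₂ (row s′ t (proj₂ (row r′ b v))))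

exchange-zeros : (r : Vector Entry m) (h : Label n) (v : Vector (Label n) m) →
                 Exchange zeros r r zeros nothing h h nothing v
exchange-zeros r h v with e , u ← row-cong {v = r} {l = h} (λ _ → refl) refl (proj₂ (row-zeros v)) =
  e , λ j → trans (u j) (sym (proj₂ (row-zeros (proj₂ (row r h v))) j))

-- Between the two elbows, the left edges of the exchanged rows carry the two
-- labels of the original ones in sorted order.
exchange-ray : (b : Fin m) (r : Vector Entry m) (v : Vector (Label n) m) (x h : Label n) {bt : Label n × Label n} →
  (∀ j → j ≤ b → r j ≡ 𝟎) → v b ≡ nothing → cross h x ≡ bt →
  Exchange (ray b) r r (ray b) x h (proj₁ bt) (proj₂ bt) v
exchange-ray zero r v x h r≡𝟎 vb refl
  rewrite r≡𝟎 zero z≤n | vb | cross-nothing (proj₁ (cross h x))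
  with e , u ← exchange-zeros (r ∘ suc) (proj₁ (cross h x)) (v ∘ suc) = e , ∷-≗ refl u
exchange-ray (suc b) r v x h r≡𝟎 vb refl
  rewrite r≡𝟎 zero z≤n
  with bt , o ← yang-baxter h x (v zero)
  with e , u ← exchange-ray b (r ∘ suc) (v ∘ suc) (proj₁ (cross x (v zero)))
         (proj₁ (cross h (proj₂ (cross x (v zero))))) (λ j j≤b → r≡𝟎 (suc j) (s≤s j≤b)) vb bt
  = e , ∷-≗ o u

-- Left of column q the dipole lets every label through. In column q the label from below is picked
-- up directly in one order, and after crossing the label that arrives from the left in the other.
-- The left edges then differ by one crossing, as `exchange-ray` requires.
exchange-dipole : (q b : Fin m) (r : Vector Entry m) (v : Vector (Label n) m) (h : Label n) →
  q < b → (∀ j → q ≤ j → j ≤ b → r j ≡ 𝟎) → v b ≡ nothing →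
  Exchange (dipole q b) r r (dipole q b) nothing h h nothing v
exchange-dipole zero (suc b) r v h q<b r≡𝟎 vb
  rewrite r≡𝟎 zero z≤n z≤n | cross-nothing h
  with e , u ← exchange-ray b (r ∘ suc) (v ∘ suc) (v zero) h (λ j j≤b → r≡𝟎 (suc j) z≤n (s≤s j≤b)) vb refl
  = e , ∷-≗ refl u
exchange-dipole (suc q) (suc b) r v h (s≤s q<b) r≡𝟎 vb
  with e , u ← exchange-dipole q b (r ∘ suc) (v ∘ suc) (proj₁ (cell (r zero) h (v zero))) q<b
                 (λ j q≤j j≤b → r≡𝟎 (suc j) (s≤s q≤j) (s≤s j≤b)) vb
  = e , ∷-≗ refl u

cross-sorted : (x y : Fin n) → let l , t = cross (just x) (just y) in cross t l ≡ (l , t)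
cross-sorted x y with ≤-total x y
... | inj₁ x≤y rewrite cross-≤ x≤y = cross-≥ x≤y
... | inj₂ y≤x rewrite cross-≥ y≤x = cross-≥ y≤x

cross-defined : (x : Fin n) (l : Label n) → is-just (proj₁ (cross (just x) l)) ≡ true
cross-defined x nothing = refl
cross-defined x (just y) with does (x ≤? y)
... | true  = refl
... | false = refl

-- In column p the larger of the two labels turns right in the upper row in either order, and the
-- smaller one stays in the lower row. By `cross-sorted` this pair meets the hypothesis of
-- `exchange-ray`. Both labels must be present, since `cross` does not sort an absent one.
exchange-pivot-inside : (p b : Fin m) (v : Vector (Label n) m) (x : Label n) →
  p < b → is-just x ≡ true → is-just (v p) ≡ true → v b ≡ nothing →
  Exchange (ray b) (unit p) zeros (dipole p b) x nothing x nothing v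
exchange-pivot-inside zero (suc b) v (just x) p<b _ vp vb with v zero | vp
... | just y | _
  with e , u ← exchange-ray b zeros (v ∘ suc) (proj₁ (cross (just x) (just y))) (proj₂ (cross (just x) (just y)))
                 (λ _ _ → refl) vb (cross-sorted x y)
  = e , ∷-≗ refl u
exchange-pivot-inside (suc p) (suc b) v (just x) (s≤s p<b) _ vp vb
  with e , u ← exchange-pivot-inside p b (v ∘ suc) _ p<b (cross-defined x (v zero)) vp vb
  = e , ∷-≗ refl u

-- Between columns q and p both orders carry the pipe from column q along the lower row.
exchange-pivot : (q p b : Fin m) (v : Vector (Label n) m) →
  q < p → p < b → is-just (v q) ≡ true → is-just (v p) ≡ true → v b ≡ nothing →
  Exchange (dipole q b) (unit p) (unit q) (dipole p b) nothing nothing nothing nothing v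
exchange-pivot zero (suc p) (suc b) v q<p (s≤s p<b) vq vp vb
  with e , u ← exchange-pivot-inside p b (v ∘ suc) (v zero) p<b vq vp vb
  = e , ∷-≗ refl u
exchange-pivot (suc q) (suc p) (suc b) v (s≤s q<p) (s≤s p<b) vq vp vb
  with e , u ← exchange-pivot q p b (v ∘ suc) q<p p<b vq vp vb
  = e , ∷-≗ refl u

-- The two elbows in column b, up in the lower row and right in the upper one, cancel: the pipe may
-- as well run straight through the lower row.
exchange-last-pivot-inside : (b : Fin m) (v : Vector (Label n) m) (x : Label n) → v b ≡ nothing →
  Exchange (ray b) (unit b) zeros zeros x nothing x nothing v
exchange-last-pivot-inside zero v x vb rewrite vb | cross-nothing x
  with e , u ← exchange-zeros zeros x (v ∘ suc) = e , ∷-≗ refl u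
exchange-last-pivot-inside (suc b) v x vb
  with e , u ← exchange-last-pivot-inside b (v ∘ suc) (proj₁ (cross x (v zero))) vb
  = e , ∷-≗ refl u

exchange-last-pivot : (q b : Fin m) (v : Vector (Label n) m) → q < b → v b ≡ nothing →
  Exchange (dipole q b) (unit b) (unit q) zeros nothing nothing nothing nothing v
exchange-last-pivot zero (suc b) v q<b vb
  with e , u ← exchange-last-pivot-inside b (v ∘ suc) (v zero) vb = e , ∷-≗ refl u
exchange-last-pivot (suc q) (suc b) v (s≤s q<b) vb
  with e , u ← exchange-last-pivot q b (v ∘ suc) q<b vb = e , ∷-≗ refl u

-- Splitting the row of the removed -1

split-ray : (b : Fin m) (r r′ : Vector Entry m) (v : Vector (Label n) m) (x : Label n) →
  r b ≡ -𝟏 → (∀ j → j < b → r j ≡ 𝟎) → (∀ j → j ≤ b → r′ j ≡ 𝟎) → (∀ j → b < j → r′ j ≡ r j) →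
  row r x v ≈ (proj₁ (row r′ nothing v) , proj₂ (row (ray b) x (proj₂ (row r′ nothing v))))
split-ray zero r r′ v x rb r≡𝟎 r′≡𝟎 r′≡r rewrite rb | r′≡𝟎 zero z≤n
  with e , u ← row-cong {l = nothing} {b = v ∘ suc} (λ j → sym (r′≡r (suc j) z<s)) refl (λ _ → refl)
  = e , ∷-≗ refl (λ j → trans (u j) (sym (proj₂ (row-zeros (proj₂ (row (r′ ∘ suc) nothing (v ∘ suc)))) j)))
split-ray (suc b) r r′ v x rb r≡𝟎 r′≡𝟎 r′≡r rewrite r≡𝟎 zero z<s | r′≡𝟎 zero z≤n
  with e , u ← split-ray b (r ∘ suc) (r′ ∘ suc) (v ∘ suc) (proj₁ (cross x (v zero))) rb
                 (λ j j<b → r≡𝟎 (suc j) (s<s j<b)) (λ j j≤b → r′≡𝟎 (suc j) (s≤s j≤b)) (λ j b<j → r′≡r (suc j) (s<s b<j))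
  = e , ∷-≗ refl u

-- Up to column b the row `r′` only lets labels through, so the dipole above it does what `r` does.
-- Beyond b the dipole is empty, and `r′` agrees with `r`, both continuing without a label from the
-- left.
split-dipole : (q b : Fin m) (r r′ : Vector Entry m) (v : Vector (Label n) m) →
  q < b → r q ≡ 𝟏 → r b ≡ -𝟏 → (∀ j → j < b → j ≢ q → r j ≡ 𝟎) →
  (∀ j → j ≤ b → r′ j ≡ 𝟎) → (∀ j → b < j → r′ j ≡ r j) →
  row r nothing v ≈ (proj₁ (row r′ nothing v) , proj₂ (row (dipole q b) nothing (proj₂ (row r′ nothing v))))
split-dipole zero (suc b) r r′ v q<b rq rb r≡𝟎 r′≡𝟎 r′≡r rewrite rq | r′≡𝟎 zero z≤n
  with e , u ← split-ray b (r ∘ suc) (r′ ∘ suc) (v ∘ suc) (v zero) rb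
                 (λ j j<b → r≡𝟎 (suc j) (s<s j<b) λ ()) (λ j j≤b → r′≡𝟎 (suc j) (s≤s j≤b)) (λ j b<j → r′≡r (suc j) (s<s b<j))
  = e , ∷-≗ refl u
split-dipole (suc q) (suc b) r r′ v (s≤s q<b) rq rb r≡𝟎 r′≡𝟎 r′≡r rewrite r≡𝟎 zero z<s (λ ()) | r′≡𝟎 zero z≤n
  with e , u ← split-dipole q b (r ∘ suc) (r′ ∘ suc) (v ∘ suc) q<b rq rb
                 (λ j j<b j≢q → r≡𝟎 (suc j) (s<s j<b) (j≢q ∘ suc-injective)) (λ j j≤b → r′≡𝟎 (suc j) (s≤s j≤b)) (λ j b<j → r′≡r (suc j) (s<s b<j))
  = e , ∷-≗ refl u

-- Agreement with the labelling by tiles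

propagate-tile : ∀ e r d {l b : Label n} →
  is-just l ≡ left (tile-of e r d) → is-just b ≡ bottom (tile-of e r d) →
  propagate (tile-of e r d) l b ≡ cell e l b
propagate-tile 𝟏  _     _     _ _ = refl
propagate-tile -𝟏 _     _     _ _ = refl
-- The two Booleans of a zero tile say which labels are present, and this selects the clause of
-- `cross`.
propagate-tile 𝟎  true  true  {just _}  {just _}  _ _ = refl
propagate-tile 𝟎  true  false {just _}  {nothing} _ _ = refl
propagate-tile 𝟎  false true  {nothing} {just _}  _ _ = refl
propagate-tile 𝟎  false false {nothing} {nothing} _ _ = refl

Realizes : (Fin m → Tile) → Vector Entry m → Set
Realizes t v = ∀ j → ∃₂ λ r d → t j ≡ tile-of (v j) r d

propagate-row≈row : ∀ {c d} {t : Fin m → Tile} {v : Vector Entry m} → Realizes t v → Chain left right c t d →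
  {l : Label n} {b : Vector (Label n) m} → is-just l ≡ c → (∀ j → is-just (b j) ≡ bottom (t j)) →
  propagate-row t l b ≈ row v l b
propagate-row≈row t≡ nil p q = refl , λ _ → refl
propagate-row≈row {t = t} {v} t≡ (cons s ch) {l} {b} p q with r , d , t₀≡ ← t≡ zero
  with propagate-row≈row {v = v ∘ suc} (t≡ ∘ suc) ch
         (proj₁ (propagate-defined (t zero) (trans p (sym s)) (q zero))) (q ∘ suc)
     | propagate-tile (v zero) r d {l} {b zero} (trans p (trans (sym s) (cong left t₀≡))) (trans (q zero) (cong bottom t₀≡))
... | ih | step rewrite t₀≡ | step = proj₁ ih , ∷-≗ refl (proj₂ ih)

propagate-rows≗rows : {t : Fin k → Fin m → Tile} {A : Fin k → Vector Entry m} {c : Fin m → Bool} →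
  (∀ i → Realizes (t i) (A i)) →
  (∀ i → Chain left right false (t i) true) → (∀ j → Chain top bottom (c j) (λ i → t i j) true) →
  {b : Vector (Label n) m} → (∀ j → is-just (b j) ≡ true) →
  proj₁ (propagate-rows t b) ≗ proj₁ (rows A b) × proj₂ (propagate-rows t b) ≗ proj₂ (rows A b)
propagate-rows≗rows {zero}  t≡ rc cc q = (λ ()) , λ _ → refl
propagate-rows≗rows {suc k} {A = A} t≡ rc cc q
  with es , us ← propagate-rows≗rows {A = A ∘ suc} (t≡ ∘ suc) (rc ∘ suc) (uncons-tail ∘ cc) q
  with e , vs ← propagate-row≈row (t≡ zero) (rc zero) {l = nothing} refl
                  (proj₂ (rows-defined (rc ∘ suc) (uncons-tail ∘ cc) q))
  with e′ , vs′ ← row-cong {v = A zero} {l = nothing} (λ _ → refl) refl us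
  = ∷-≗ (trans e e′) es , λ j → trans (vs j) (vs′ j)

exit-label-Φ : (A : ASM n) → exit-label (Φ A) ≗ proj₁ (rows (matrix A) just)
exit-label-Φ A = proj₁ (propagate-rows≗rows (λ i j → _ , _ , refl)
                   (proj₁ (chained (Φ A))) (proj₂ (chained (Φ A))) (λ _ → refl))

-- Rows and columns as runs of partial sums

nil-run : ∀ {c} {v : Vector Entry 0} → Run c v → c ≡ true
nil-run nil = refl

run-head : ∀ {c} {v : Vector Entry (suc m)} → Run c v → ∃ λ d → Step c (v zero) d × Run d (v ∘ suc)
run-head (cons s r) = _ , s , r

run-cong : ∀ {c} {v v′ : Vector Entry m} → v ≗ v′ → Run c v → Run c v′
run-cong v≗v′ nil        = nil
run-cong v≗v′ (cons s r) = cons (subst (λ e → Step _ e _) (v≗v′ zero) s) (run-cong (v≗v′ ∘ suc) r)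

zeros-run : Run true (zeros {m})
zeros-run {zero}  = nil
zeros-run {suc m} = cons stay zeros-run

unit-run : (p : Fin m) → Run false (unit p)
unit-run zero    = cons up zeros-run
unit-run (suc p) = cons stay (unit-run p)

step-𝟏 : ∀ {c d e} → e ≡ 𝟏 → Step c e d → c ≡ false × d ≡ true
step-𝟏 refl up = refl , refl

step-𝟎 : ∀ {c d e} → e ≡ 𝟎 → Step c e d → c ≡ d
step-𝟎 refl stay = refl

step--𝟏 : ∀ {c d e} → e ≡ -𝟏 → Step c e d → c ≡ true × d ≡ false
step--𝟏 refl down = refl , refl

nonnegative⇒zeros : {v : Vector Entry m} → Run true v → (∀ j → v j ≢ -𝟏) → v ≗ zeros
nonnegative⇒zeros {zero} _ _ ()
nonnegative⇒zeros {suc m} {v} r v≢-𝟏 with v zero in v₀ | run-head r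
... | -𝟏 | _ , down , _  = ⊥-elim (v≢-𝟏 zero v₀)
... | 𝟎  | _ , stay , r′ = λ { zero → v₀ ; (suc j) → nonnegative⇒zeros r′ (v≢-𝟏 ∘ suc) j }

nonnegative⇒unit : {v : Vector Entry m} → Run false v → (∀ j → v j ≢ -𝟏) → ∃ λ p → v ≗ unit p
nonnegative⇒unit {zero} ()
nonnegative⇒unit {suc m} {v} r v≢-𝟏 with v zero in v₀ | run-head r
... | 𝟏 | true , up , r′ = zero , λ { zero → v₀ ; (suc j) → nonnegative⇒zeros r′ (v≢-𝟏 ∘ suc) j }
... | 𝟎 | false , stay , r′ with p , v≗ ← nonnegative⇒unit r′ (v≢-𝟏 ∘ suc) =
  suc p , λ { zero → v₀ ; (suc j) → v≗ j }

zeros-before-first-negative : {v : Vector Entry m} {b : Fin m} → Run true v →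
  v b ≡ -𝟏 → (∀ j → j < b → v j ≢ -𝟏) → ∀ j → j < b → v j ≡ 𝟎
zeros-before-first-negative {v = v} {suc b} r vb v≢-𝟏 with v zero in v₀ | run-head r
... | -𝟏 | _ , down , _  = ⊥-elim (v≢-𝟏 zero z<s v₀)
... | 𝟎  | _ , stay , r′ = λ
  { zero    _         → v₀
  ; (suc j) (s≤s j<b) → zeros-before-first-negative r′ vb (λ l l<b → v≢-𝟏 (suc l) (s≤s l<b)) j j<b }

-- The partial sum starts at 0, so a 1 precedes the first -1; a second 1 would need another -1 in
-- between.
𝟏-before-first-negative : {v : Vector Entry m} {b : Fin m} → Run false v →
  v b ≡ -𝟏 → (∀ j → j < b → v j ≢ -𝟏) →
  ∃ λ q → q < b × v q ≡ 𝟏 × (∀ j → j < b → j ≢ q → v j ≡ 𝟎)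
𝟏-before-first-negative {b = zero} (cons s _) vb _ = case proj₁ (step--𝟏 vb s) of λ ()
𝟏-before-first-negative {v = v} {suc b} r vb v≢-𝟏 with v zero in v₀ | run-head r
... | 𝟏 | _ , up , r′ = zero , z<s , v₀ , λ
  { zero    _         0≢0 → ⊥-elim (0≢0 refl)
  ; (suc j) (s≤s j<b) _   → zeros-before-first-negative r′ vb (λ l l<b → v≢-𝟏 (suc l) (s≤s l<b)) j j<b }
... | 𝟎 | _ , stay , r′
  with q , q<b , vq , v≡𝟎 ← 𝟏-before-first-negative r′ vb (λ l l<b → v≢-𝟏 (suc l) (s≤s l<b))
  = suc q , s≤s q<b , vq , λ { zero _ _ → v₀ ; (suc j) (s≤s j<b) j≢q → v≡𝟎 j j<b (j≢q ∘ cong suc) }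

-- Just after column b both partial sums are 0: that of `v` has dropped to it, that of `v′` never
-- left it.
erase-run : ∀ {c} (b : Fin m) {v v′ : Vector Entry m} → Run c v → v b ≡ -𝟏 →
  (∀ j → j ≤ b → v′ j ≡ 𝟎) → (∀ j → b < j → v′ j ≡ v j) → Run false v′
erase-run zero {v′ = v′} (cons s r) vb v′≡𝟎 v′≡v with refl ← proj₂ (step--𝟏 vb s) =
  cons (subst (λ e → Step false e false) (sym (v′≡𝟎 zero z≤n)) stay)
       (run-cong (λ j → sym (v′≡v (suc j) z<s)) r)
erase-run (suc b) (cons _ r) vb v′≡𝟎 v′≡v =
  cons (subst (λ e → Step false e false) (sym (v′≡𝟎 zero z≤n)) stay)
       (erase-run b r vb (λ j j≤b → v′≡𝟎 (suc j) (s≤s j≤b)) (λ j b<j → v′≡v (suc j) (s<s b<j)))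

-- Which edges are met by pipes

-- The Booleans c say which top edges of A are met by a pipe.
record Grid (c : Fin m → Bool) (A : Fin k → Vector Entry m) : Set where
  field
    row-run    : ∀ i → Run false (A i)
    column-run : ∀ j → Run (c j) (λ i → A i j)

open Grid

grid-tail : ∀ {c} {A : Fin (suc k) → Vector Entry m} → Grid c A →
            ∃ λ c₁ → (∀ j → Step (c j) (A zero j) (c₁ j)) × Grid c₁ (A ∘ suc)
grid-tail g =
  (λ j → proj₁ (run-head (column-run g j))) , (λ j → proj₁ (proj₂ (run-head (column-run g j)))) ,
  record { row-run = row-run g ∘ suc ; column-run = λ j → proj₂ (proj₂ (run-head (column-run g j))) }

grid-cons : ∀ {c c₁} {A : Fin (suc k) → Vector Entry m} → Run false (A zero) →
            (∀ j → Step (c j) (A zero j) (c₁ j)) → Grid c₁ (A ∘ suc) → Grid c A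
grid-cons r s g = record
  { row-run    = λ { zero → r ; (suc i) → row-run g i }
  ; column-run = λ j → cons (s j) (column-run g j) }

cell-presence : ∀ {c d t b e} {x y : Label n} → Step c e d → Step t e b → is-just x ≡ c → is-just y ≡ b →
                is-just (proj₁ (cell e x y)) ≡ d × is-just (proj₂ (cell e x y)) ≡ t
cell-presence up   up   p q = q , refl
cell-presence down down p q = refl , p
cell-presence {x = nothing} stay stay p q = p , q
cell-presence {x = just _} {nothing} stay stay p q = p , q
cell-presence {x = just x} {just y} stay stay p q with does (x ≤? y)
... | true  = p , q
... | false = p , q

row-presence : ∀ {c} {t d : Fin m → Bool} {v : Vector Entry m} → Run c v → (∀ j → Step (t j) (v j) (d j)) →
  {l : Label n} {b : Vector (Label n) m} → is-just l ≡ c → (∀ j → is-just (b j) ≡ d j) →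
  ∀ j → is-just (proj₂ (row v l b) j) ≡ t j
row-presence (cons s r) ss p q zero    = proj₂ (cell-presence s (ss zero) p (q zero))
row-presence (cons s r) ss p q (suc j) = row-presence r (ss ∘ suc) (proj₁ (cell-presence s (ss zero) p (q zero))) (q ∘ suc) j

-- Partial sums decide which labels are present, whatever happens at crossings. This supplies the
-- presence hypotheses of the exchange lemmas.
rows-presence : ∀ {c} {A : Fin k → Vector Entry m} → Grid c A → {b : Vector (Label n) m} → (∀ j → is-just (b j) ≡ true) →
  ∀ j → is-just (proj₂ (rows A b) j) ≡ c j
rows-presence {zero} g q j = trans (q j) (sym (nil-run (column-run g j)))
rows-presence {suc k} g q with _ , s , g₁ ← grid-tail g = row-presence (row-run g zero) s refl (rows-presence g₁ q)

-- Pivots, corners and inflation in rectangular matrices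

-- The notions of Defs for rectangular matrices, so that top rows can be removed;
-- for square ones Pivot, Consecutive and Corner are definitionally those of Defs.
module _ (A : Fin k → Vector Entry m) (a : Fin k) (b : Fin m) where

  Pivot : Fin k → Fin m → Set
  Pivot i j = (i , j) ≢ (a , b) × i ≤ a × j ≤ b × A i j ≡ 𝟏 ×
    (∀ x y → i ≤ x → x ≤ a → j ≤ y → y ≤ b → A x y ≢ 𝟎 →
      (x , y) ≡ (i , j) ⊎ (x , y) ≡ (a , b))

  Consecutive : Fin k → Fin m → Fin k → Fin m → Set
  Consecutive i j i′ j′ = Pivot i j × Pivot i′ j′ × i < i′ ×
    (∀ x y → Pivot x y → ¬ (i < x × x < i′))

  Corner : Fin k → Fin m → Set
  Corner i j = ∃₂ λ j₀ i′ → Consecutive i j₀ i′ j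

  -- A description by entries, unlike the function `inflate` on square matrices, passes to the
  -- matrix without its top row.
  record Inflates (A′ : Fin k → Vector Entry m) : Set where
    field
      corner : ∀ {i j} → Corner i j → A′ i j ≡ 𝟏
      erased : ∀ {i j} → ¬ Corner i j → (i , j) ≡ (a , b) ⊎ Pivot i j → A′ i j ≡ 𝟎
      kept   : ∀ {i j} → ¬ Corner i j → (i , j) ≢ (a , b) → ¬ Pivot i j → A′ i j ≡ A i j

  First-negative : Set
  First-negative = A a b ≡ -𝟏 × (∀ i j → i < a → A i j ≢ -𝟏) × (∀ j → j < b → A a j ≢ -𝟏)

open Inflates

suc-≡ : {i x : Fin k} {j y : Fin m} → (i , j) ≡ (x , y) → _≡_ {A = Fin (suc k) × Fin m} (suc i , j) (suc x , y)
suc-≡ refl = refl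

pred-≡ : {i x : Fin k} {j y : Fin m} → _≡_ {A = Fin (suc k) × Fin m} (suc i , j) (suc x , y) → (i , j) ≡ (x , y)
pred-≡ refl = refl

module _ {A : Fin (suc k) → Vector Entry m} {a : Fin k} {b : Fin m} where

  -- Pivots and corners depend only on the rows from their own down to a, so removing the top row
  -- changes none of those that remain.
  pivot-suc : ∀ {i j} → Pivot (A ∘ suc) a b i j → Pivot A (suc a) b (suc i) j
  pivot-suc (ij≢ab , i≤a , j≤b , Aij , only) = ij≢ab ∘ pred-≡ , s≤s i≤a , j≤b , Aij ,
    λ { (suc x) y (s≤s i≤x) (s≤s x≤a) j≤y y≤b nz → map⊎ suc-≡ suc-≡ (only x y i≤x x≤a j≤y y≤b nz) }

  pivot-pred : ∀ {i j} → Pivot A (suc a) b (suc i) j → Pivot (A ∘ suc) a b i j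
  pivot-pred (ij≢ab , s≤s i≤a , j≤b , Aij , only) = ij≢ab ∘ suc-≡ , i≤a , j≤b , Aij ,
    λ x y i≤x x≤a j≤y y≤b nz → map⊎ pred-≡ pred-≡ (only (suc x) y (s≤s i≤x) (s≤s x≤a) j≤y y≤b nz)

  corner-suc : ∀ {i j} → Corner (A ∘ suc) a b i j → Corner A (suc a) b (suc i) j
  corner-suc (j₀ , i′ , P , P′ , i<i′ , none) = j₀ , suc i′ , pivot-suc P , pivot-suc P′ , s≤s i<i′ ,
    λ { (suc x) y Q (s≤s i<x , s≤s x<i′) → none x y (pivot-pred Q) (i<x , x<i′) }

  corner-pred : ∀ {i j} → Corner A (suc a) b (suc i) j → Corner (A ∘ suc) a b i j
  corner-pred (j₀ , suc i′ , P , P′ , s≤s i<i′ , none) = j₀ , i′ , pivot-pred P , pivot-pred P′ , i<i′ ,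
    λ x y Q (i<x , x<i′) → none (suc x) y (pivot-suc Q) (s≤s i<x , s≤s x<i′)

  inflates-tail : {A′ : Fin (suc k) → Vector Entry m} → Inflates A (suc a) b A′ → Inflates (A ∘ suc) a b (A′ ∘ suc)
  inflates-tail I = record
    { corner = corner I ∘ corner-suc
    ; erased = λ ¬C → erased I (¬C ∘ corner-pred) ∘ map⊎ suc-≡ pivot-suc
    ; kept   = λ ¬C ij≢ab ¬P → kept I (¬C ∘ corner-pred) (ij≢ab ∘ pred-≡) (¬P ∘ pivot-pred)
    }

-- Comparison of a matrix with its inflation

-- c and c′ say which top edges are met by a pipe in A and in its inflation, and
-- u and u′ are the labels there.  The relation is pending as long as the pivot
-- in column b lies above A; (i , q) is then the topmost pivot of A.
data Related (A : Fin k → Vector Entry m) (a : Fin k) (b : Fin m)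
             (c c′ : Fin m → Bool) (u u′ : Vector (Label n) m) : Set where
  pending : ∀ {i q} → Pivot A a b i q →
    (∀ x y → Pivot A a b x y → i < x ⊎ (x ≡ i × y ≡ q)) →
    (∀ x y → x ≤ a → q < y → y ≤ b → A x y ≢ 𝟎 → (x , y) ≡ (a , b)) →
    q < b → c b ≡ true → c q ≡ false → c′ b ≡ false → c′ q ≡ true →
    (∀ j → j ≢ q → j ≢ b → c′ j ≡ c j) →
    u ≗ proj₂ (row (dipole q b) nothing u′) →
    Related A a b c c′ u u′
  complete : ∀ {i} → i ≤ a → A i b ≡ 𝟏 → c′ ≗ c → u ≗ u′ → Related A a b c c′ u u′

Simulates : (A A′ : Fin k → Vector Entry m) (a : Fin k) (b : Fin m) (c : Fin m → Bool) (ℓ : Vector (Label n) m) → Set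
Simulates A A′ a b c ℓ = ∃ λ c′ → Grid c′ A′ × proj₁ (rows A ℓ) ≗ proj₁ (rows A′ ℓ) ×
  Related A a b c c′ (proj₂ (rows A ℓ)) (proj₂ (rows A′ ℓ))

absent : {l : Label n} → is-just l ≡ false → l ≡ nothing
absent {l = nothing} _ = refl

-- Here a is the top row, and the 1 before column b is the only pivot. A corner would need a further
-- pivot below it, so inflation merely erases this 1 and the -1, and `split-dipole` yields the extra
-- row.
simulates-base : {A A′ : Fin (suc k) → Vector Entry m} {b : Fin m} {c : Fin m → Bool} {ℓ : Vector (Label n) m} →
  Grid c A → First-negative A zero b → Inflates A zero b A′ → Simulates A A′ zero b c ℓ
simulates-base {A = A} {A′} {b} {c} {ℓ} g (Ab≡-𝟏 , _ , before) I
  with q , q<b , Aq , A≡𝟎 ← 𝟏-before-first-negative (row-run g zero) Ab≡-𝟏 before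
  with c₁ , s , g₁ ← grid-tail g
  = c′ , grid-cons (erase-run b (row-run g zero) Ab≡-𝟏 A′≡𝟎 A′≡A) s′
           (record { row-run = λ i → run-cong (λ j → sym (below i j)) (row-run g₁ i)
                   ; column-run = λ j → run-cong (λ i → sym (below i j)) (column-run g₁ j) })
       , ∷-≗ (trans (proj₁ split) (proj₁ below-row)) es
       , pending pivot (λ x y P → inj₂ (topmost x y P)) empty q<b cb cq c′b c′q c′≡c
           (λ j → trans (proj₂ split j) (proj₂ (row-cong {v = dipole q b} (λ _ → refl) refl (proj₂ below-row)) j))
  where
  q≢b : q ≢ b
  q≢b = Finₚ.<⇒≢ q<b

  nonzero : ∀ y → y ≤ b → A zero y ≢ 𝟎 → y ≡ q ⊎ y ≡ b
  nonzero y y≤b nz with y ≟ q | y ≟ b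
  ... | yes e | _     = inj₁ e
  ... | no _  | yes e = inj₂ e
  ... | no y≢q | no y≢b = ⊥-elim (nz (A≡𝟎 y (Finₚ.≤∧≢⇒< y≤b y≢b) y≢q))

  pivot : Pivot A zero b zero q
  pivot = (λ e → q≢b (cong proj₂ e)) , z≤n , ℕₚ.<⇒≤ q<b , Aq , only
    where
    only : ∀ (x : Fin (suc _)) y → zero {n = 0} ≤ x → x ≤ zero {n = 0} → q ≤ y → y ≤ b → A x y ≢ 𝟎 →
           (x , y) ≡ (zero , q) ⊎ (x , y) ≡ (zero , b)
    only zero y _ _ _ y≤b nz = map⊎ (cong (zero ,_)) (cong (zero ,_)) (nonzero y y≤b nz)

  topmost : ∀ x y → Pivot A zero b x y → x ≡ zero × y ≡ q
  topmost zero y (ne , _ , y≤b , Ay , _) with nonzero y y≤b (λ e → case trans (sym Ay) e of λ ())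
  ... | inj₁ e = refl , e
  ... | inj₂ e = ⊥-elim (ne (cong (zero ,_) e))

  empty : ∀ x y → x ≤ zero {n = 0} → q < y → y ≤ b → A x y ≢ 𝟎 → (x , y) ≡ (zero , b)
  empty zero y _ q<y y≤b nz with nonzero y y≤b nz
  ... | inj₁ e = ⊥-elim (Finₚ.<⇒≢ q<y (sym e))
  ... | inj₂ e = cong (zero ,_) e

  ¬corner : ∀ {i j} → ¬ Corner A zero b i j
  ¬corner (_ , suc _ , _ , (_ , () , _) , _)

  A′≡𝟎 : ∀ j → j ≤ b → A′ zero j ≡ 𝟎
  A′≡𝟎 j j≤b with j ≟ q | j ≟ b
  ... | yes refl | _        = erased I ¬corner (inj₂ pivot)
  ... | no _     | yes refl = erased I ¬corner (inj₁ refl)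
  ... | no j≢q   | no j≢b   = trans
    (kept I ¬corner (j≢b ∘ cong proj₂) (j≢q ∘ proj₂ ∘ topmost zero j)) (A≡𝟎 j (Finₚ.≤∧≢⇒< j≤b j≢b) j≢q)

  A′≡A : ∀ j → b < j → A′ zero j ≡ A zero j
  A′≡A j b<j = kept I ¬corner (λ e → Finₚ.<⇒≢ b<j (sym (cong proj₂ e))) λ P → ℕₚ.<⇒≱ b<j (proj₁ (proj₂ (proj₂ P)))

  below : ∀ i j → A′ (suc i) j ≡ A (suc i) j
  below i j = kept I ¬corner (λ ()) λ { (_ , () , _) }

  us : proj₁ (rows (A ∘ suc) ℓ) ≗ proj₁ (rows (A′ ∘ suc) ℓ) × proj₂ (rows (A ∘ suc) ℓ) ≗ proj₂ (rows (A′ ∘ suc) ℓ)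
  us = rows-cong λ i j → sym (below i j)

  es = proj₁ us

  split = split-dipole q b (A zero) (A′ zero) (proj₂ (rows (A ∘ suc) ℓ)) q<b Aq Ab≡-𝟏 A≡𝟎 A′≡𝟎 A′≡A

  below-row : row (A′ zero) nothing (proj₂ (rows (A ∘ suc) ℓ)) ≈ row (A′ zero) nothing (proj₂ (rows (A′ ∘ suc) ℓ))
  below-row = row-cong {v = A′ zero} (λ _ → refl) refl (proj₂ us)

  -- Up to column b the erased row lets every pipe through vertically; beyond b the two rows agree.
  c′ : Fin _ → Bool
  c′ j = if does (j ≤? b) then c₁ j else c j

  c′-≤ : ∀ {j} → j ≤ b → c′ j ≡ c₁ j
  c′-≤ {j} j≤b rewrite dec-true (j ≤? b) j≤b = refl

  s′ : ∀ j → Step (c′ j) (A′ zero j) (c₁ j)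
  s′ j with j ≤? b
  ... | yes j≤b rewrite A′≡𝟎 j j≤b | dec-true (j ≤? b) j≤b = stay
  ... | no j≰b rewrite A′≡A j (ℕₚ.≰⇒> j≰b) | dec-false (j ≤? b) j≰b = s j

  cb : c b ≡ true
  cb = proj₁ (step--𝟏 Ab≡-𝟏 (s b))

  cq : c q ≡ false
  cq = proj₁ (step-𝟏 Aq (s q))

  c′b : c′ b ≡ false
  c′b = trans (c′-≤ Finₚ.≤-refl) (proj₂ (step--𝟏 Ab≡-𝟏 (s b)))

  c′q : c′ q ≡ true
  c′q = trans (c′-≤ (ℕₚ.<⇒≤ q<b)) (proj₂ (step-𝟏 Aq (s q)))

  c′≡c : ∀ j → j ≢ q → j ≢ b → c′ j ≡ c j
  c′≡c j j≢q j≢b with j ≤? b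
  ... | yes j≤b = trans (c′-≤ j≤b) (sym (step-𝟎 (A≡𝟎 j (Finₚ.≤∧≢⇒< j≤b j≢b) j≢q) (s j)))
  ... | no j≰b rewrite dec-false (j ≤? b) j≰b = refl

related-cong : ∀ {A : Fin k → Vector Entry m} {a b c c′} {u u′ w w′ : Vector (Label n) m} →
  u ≗ w → u′ ≗ w′ → Related A a b c c′ u u′ → Related A a b c c′ w w′
related-cong {b = b} u≗w u′≗w′ (pending {q = q} P topmost empty q<b cb cq c′b c′q c′≡c slide) =
  pending P topmost empty q<b cb cq c′b c′q c′≡c λ j →
    trans (sym (u≗w j)) (trans (slide j) (proj₂ (row-cong {v = dipole q b} (λ _ → refl) refl u′≗w′) j))
related-cong u≗w u′≗w′ (complete i≤a Aib c′≗c u≗u′) =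
  complete i≤a Aib c′≗c λ j → trans (sym (u≗w j)) (trans (u≗u′ j) (u′≗w′ j))

-- The pipe coming up in column p turns right at the 1 of `unit p` and is missing on the line above.
unset : Fin m → (Fin m → Bool) → Fin m → Bool
unset p d j = if does (p ≟ j) then false else d j

unset-at : (p : Fin m) (d : Fin m → Bool) → unset p d p ≡ false
unset-at p d rewrite dec-true (p ≟ p) refl = refl

unset-off : {p j : Fin m} (d : Fin m → Bool) → j ≢ p → unset p d j ≡ d j
unset-off {p = p} {j} d j≢p rewrite dec-false (p ≟ j) (j≢p ∘ sym) = refl

unset-step : (p : Fin m) {d : Fin m → Bool} → d p ≡ true → ∀ j → Step (unset p d j) (unit p j) (d j)
unset-step p dp j with p ≟ j
... | yes refl rewrite dp = up
... | no _ = stay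

module _ {A A′ : Fin (suc k) → Vector Entry m} {a : Fin k} {b : Fin m} {c c₁ c₁′ : Fin m → Bool} {ℓ : Vector (Label n) m}
  (ℓ-defined : ∀ j → is-just (ℓ j) ≡ true)
  (g : Grid c A) {p : Fin m} (A₀ : A zero ≗ unit p) (A-negative : A (suc a) b ≡ -𝟏) (I : Inflates A (suc a) b A′)
  (s : ∀ j → Step (c j) (A zero j) (c₁ j)) (g₁′ : Grid c₁′ (A′ ∘ suc))
  (es : proj₁ (rows (A ∘ suc) ℓ) ≗ proj₁ (rows (A′ ∘ suc) ℓ))
  where

  private
    u u′ : Vector (Label n) m
    u  = proj₂ (rows (A ∘ suc) ℓ)
    u′ = proj₂ (rows (A′ ∘ suc) ℓ)

    ≢𝟎 : ∀ {e} → e ≡ 𝟏 → e ≢ 𝟎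
    ≢𝟎 refl ()

    nonzero⇒p : ∀ {j} → A zero j ≢ 𝟎 → j ≡ p
    nonzero⇒p {j} nz with j ≟ p
    ... | yes e = e
    ... | no j≢p = ⊥-elim (nz (trans (A₀ j) (unit-off j≢p)))

    A₀p : A zero p ≡ 𝟏
    A₀p = trans (A₀ p) (unit-at p)

    cp : c p ≡ false
    cp = proj₁ (step-𝟏 A₀p (s p))

    c₁p : c₁ p ≡ true
    c₁p = proj₂ (step-𝟏 A₀p (s p))

    c≡c₁ : ∀ {j} → j ≢ p → c j ≡ c₁ j
    c≡c₁ {j} j≢p = step-𝟎 (trans (A₀ j) (unit-off j≢p)) (s j)

    pivot⇒p : ∀ {j} → Pivot A (suc a) b zero j → j ≡ p
    pivot⇒p (_ , _ , _ , Aj , _) = nonzero⇒p (≢𝟎 Aj)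

    -- A corner lies in the row of a pivot, so a top row without pivots is kept by inflation.
    unpivoted : ¬ Pivot A (suc a) b zero p → A′ zero ≗ unit p
    unpivoted ¬P j = trans (kept I (λ (j₀ , _ , P , _) → ¬pivot P) (λ ()) ¬pivot) (A₀ j)
      where
      ¬pivot : ∀ {j} → ¬ Pivot A (suc a) b zero j
      ¬pivot P with refl ← pivot⇒p P = ¬P P

    blocked : ∀ {i j} → i ≤ a → A (suc i) j ≡ 𝟏 → p ≤ j → j ≤ b → ¬ Pivot A (suc a) b zero p
    blocked {i} {j} i≤a Aij p≤j j≤b (_ , _ , _ , _ , only)
      with only (suc i) j z≤n (s≤s i≤a) p≤j j≤b (≢𝟎 Aij)
    ... | inj₁ ()
    ... | inj₂ refl = case trans (sym A-negative) Aij of λ ()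

    -- The common end of all cases, which differ only in the column of the 1 in the inflated row and
    -- in the relation on the line above.
    conclude : (p′ : Fin m) → A′ zero ≗ unit p′ → c₁′ p′ ≡ true →
      proj₁ (row (unit p) nothing u) ≡ proj₁ (row (unit p′) nothing u′) →
      Related A (suc a) b c (unset p′ c₁′) (proj₂ (row (unit p) nothing u)) (proj₂ (row (unit p′) nothing u′)) →
      Simulates A A′ (suc a) b c ℓ
    conclude p′ A₀′ c₁′p′ e R =
      unset p′ c₁′ ,
      grid-cons (run-cong (sym ∘ A₀′) (unit-run p′))
                (λ j → subst (λ x → Step _ x _) (sym (A₀′ j)) (unset-step p′ c₁′p′ j)) g₁′ ,
      ∷-≗ (trans (proj₁ new) (trans e (sym (proj₁ new′)))) es ,
      related-cong (sym ∘ proj₂ new) (sym ∘ proj₂ new′) R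
      where
      new : row (A zero) nothing u ≈ row (unit p) nothing u
      new = row-cong A₀ refl λ _ → refl

      new′ : row (A′ zero) nothing u′ ≈ row (unit p′) nothing u′
      new′ = row-cong A₀′ refl λ _ → refl

  -- Once complete, the 1 in column b rules out pivots further up, and the top rows agree. While
  -- pending, the 1 in column p is a pivot exactly if q < p and p ≤ b; otherwise the dipole slides
  -- through the row unchanged.
  simulates-step : Related (A ∘ suc) a b c₁ c₁′ u u′ → Simulates A A′ (suc a) b c ℓ
  simulates-step (complete {i} i≤a Aib c₁′≗c₁ u≗u′) =
    conclude p (unpivoted λ P → blocked i≤a Aib (proj₁ (proj₂ (proj₂ P))) Finₚ.≤-refl P)
      (trans (c₁′≗c₁ p) c₁p) (proj₁ same) (complete (s≤s i≤a) Aib c′≗c (proj₂ same))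
    where
    same : row (unit p) nothing u ≈ row (unit p) nothing u′
    same = row-cong {v = unit p} (λ _ → refl) refl u≗u′

    c′≗c : unset p c₁′ ≗ c
    c′≗c j with j ≟ p
    ... | yes refl = trans (unset-at p c₁′) (sym cp)
    ... | no j≢p = trans (unset-off c₁′ j≢p) (trans (c₁′≗c₁ j) (sym (c≡c₁ j≢p)))
  simulates-step (pending {i} {q} P@(_ , i≤a , q≤b , Aiq , _) topmost empty q<b c₁b c₁q c₁′b c₁′q c₁′≡c₁ slide) =
    by-position (Finₚ.<-cmp p q) (Finₚ.<-cmp p b)
    where
    q≢b : q ≢ b
    q≢b = Finₚ.<⇒≢ q<b

    -- No pipe of A meets this line in column q, whereas the 1 in column p needs one from below.
    q≢p : q ≢ p
    q≢p refl = case trans (sym c₁q) c₁p of λ ()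

    cq : c q ≡ false
    cq = trans (c≡c₁ q≢p) c₁q

    u′b : u′ b ≡ nothing
    u′b = absent (trans (rows-presence g₁′ ℓ-defined b) c₁′b)

    u′-present : ∀ {j} → c₁′ j ≡ true → is-just (u′ j) ≡ true
    u′-present {j} = trans (rows-presence g₁′ ℓ-defined j)

    slid : row (unit p) nothing u ≈ row (unit p) nothing (proj₂ (row (dipole q b) nothing u′))
    slid = row-cong {v = unit p} (λ _ → refl) refl slide

    outside : ¬ Pivot A (suc a) b zero p → p ≢ b → (∀ j → q ≤ j → j ≤ b → j ≢ p) → Simulates A A′ (suc a) b c ℓ
    outside ¬P p≢b off =
      conclude p (unpivoted ¬P) (trans (c₁′≡c₁ p (q≢p ∘ sym) p≢b) c₁p)
        (trans (proj₁ slid) (proj₁ exchange))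
        (pending (pivot-suc P) topmost′ empty′ q<b (trans (c≡c₁ (p≢b ∘ sym)) c₁b) cq
          (trans (unset-off c₁′ (p≢b ∘ sym)) c₁′b) (trans (unset-off c₁′ q≢p) c₁′q) c′≡c
          (λ j → trans (proj₂ slid j) (proj₂ exchange j)))
      where
      exchange : Exchange (dipole q b) (unit p) (unit p) (dipole q b) nothing nothing nothing nothing u′
      exchange = exchange-dipole q b (unit p) u′ nothing q<b (λ j q≤j j≤b → unit-off (off j q≤j j≤b)) u′b

      topmost′ : ∀ x y → Pivot A (suc a) b x y → suc i < x ⊎ (x ≡ suc i × y ≡ q)
      topmost′ zero    y Q with refl ← pivot⇒p Q = ⊥-elim (¬P Q)
      topmost′ (suc x) y Q = map⊎ s≤s (λ (e , e′) → cong suc e , e′) (topmost x y (pivot-pred Q))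

      empty′ : ∀ x y → x ≤ suc a → q < y → y ≤ b → A x y ≢ 𝟎 → (x , y) ≡ (suc a , b)
      empty′ zero    y _ q<y y≤b nz = ⊥-elim (off y (ℕₚ.<⇒≤ q<y) y≤b (nonzero⇒p nz))
      empty′ (suc x) y (s≤s x≤a) q<y y≤b nz = suc-≡ (empty x y x≤a q<y y≤b nz)

      c′≡c : ∀ j → j ≢ q → j ≢ b → unset p c₁′ j ≡ c j
      c′≡c j j≢q j≢b with j ≟ p
      ... | yes refl = trans (unset-at p c₁′) (sym cp)
      ... | no j≢p = trans (unset-off c₁′ j≢p) (trans (c₁′≡c₁ j j≢q j≢b) (sym (c≡c₁ j≢p)))

    -- The new pivot in column p and the topmost old one (i , q) are consecutive, so inflation moves
    -- the 1 of the top row from column p to column q.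
    module Pivotal (q<p : q < p) (p≤b : p ≤ b) where

      pivot : Pivot A (suc a) b zero p
      pivot = (λ ()) , z≤n , p≤b , A₀p , only
        where
        only : ∀ x y → zero {n = 0} ≤ x → x ≤ suc a → p ≤ y → y ≤ b → A x y ≢ 𝟎 →
               (x , y) ≡ (zero , p) ⊎ (x , y) ≡ (suc a , b)
        only zero    y _ _ _ _ nz = inj₁ (cong (zero ,_) (nonzero⇒p nz))
        only (suc x) y _ (s≤s x≤a) p≤y y≤b nz = inj₂ (suc-≡ (empty x y x≤a (ℕₚ.<-≤-trans q<p p≤y) y≤b nz))

      first-corner : Corner A (suc a) b zero q
      first-corner = p , suc i , pivot , pivot-suc P , z<s , none
        where
        none : ∀ x y → Pivot A (suc a) b x y → ¬ (zero {n = 0} < x × x < suc i)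
        none (suc x) y Q (_ , s≤s x<i) with topmost x y (pivot-pred Q)
        ... | inj₁ i<x        = ℕₚ.<-asym x<i i<x
        ... | inj₂ (refl , _) = ℕₚ.<-irrefl refl x<i

      corner⇒q : ∀ {j} → Corner A (suc a) b zero j → j ≡ q
      corner⇒q (_ , suc x , _ , Q , _ , none) with topmost x _ (pivot-pred Q)
      ... | inj₁ i<x     = ⊥-elim (none (suc i) q (pivot-suc P) (z<s , s≤s i<x))
      ... | inj₂ (_ , e) = e

      A₀′ : A′ zero ≗ unit q
      A₀′ j with j ≟ q | j ≟ p
      ... | yes refl | _        = trans (corner I first-corner) (sym (unit-at q))
      ... | no j≢q   | yes refl = trans (erased I (j≢q ∘ corner⇒q) (inj₂ pivot)) (sym (unit-off j≢q))
      ... | no j≢q   | no j≢p   = trans (kept I (j≢q ∘ corner⇒q) (λ ()) (j≢p ∘ pivot⇒p))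
                                    (trans (A₀ j) (trans (unit-off j≢p) (sym (unit-off j≢q))))

    inside : q < p → p < b → Simulates A A′ (suc a) b c ℓ
    inside q<p p<b =
      conclude q A₀′ c₁′q (trans (proj₁ slid) (proj₁ exchange))
        (pending pivot topmost′ empty′ p<b (trans (c≡c₁ (p≢b ∘ sym)) c₁b) cp
          (trans (unset-off c₁′ (q≢b ∘ sym)) c₁′b) (trans (unset-off c₁′ (q≢p ∘ sym)) c₁′p) c′≡c
          (λ j → trans (proj₂ slid j) (proj₂ exchange j)))
      where
      open Pivotal q<p (ℕₚ.<⇒≤ p<b)

      p≢b : p ≢ b
      p≢b = Finₚ.<⇒≢ p<b

      c₁′p : c₁′ p ≡ true
      c₁′p = trans (c₁′≡c₁ p (q≢p ∘ sym) p≢b) c₁p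

      exchange : Exchange (dipole q b) (unit p) (unit q) (dipole p b) nothing nothing nothing nothing u′
      exchange = exchange-pivot q p b u′ q<p p<b (u′-present c₁′q) (u′-present c₁′p) u′b

      topmost′ : ∀ x y → Pivot A (suc a) b x y → zero {n = 0} < x ⊎ (x ≡ zero × y ≡ p)
      topmost′ zero    y Q = inj₂ (refl , pivot⇒p Q)
      topmost′ (suc x) y Q = inj₁ z<s

      empty′ : ∀ x y → x ≤ suc a → p < y → y ≤ b → A x y ≢ 𝟎 → (x , y) ≡ (suc a , b)
      empty′ zero    y _ p<y y≤b nz = ⊥-elim (Finₚ.<⇒≢ p<y (sym (nonzero⇒p nz)))
      empty′ (suc x) y (s≤s x≤a) p<y y≤b nz = suc-≡ (empty x y x≤a (ℕₚ.<-trans q<p p<y) y≤b nz)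

      c′≡c : ∀ j → j ≢ p → j ≢ b → unset q c₁′ j ≡ c j
      c′≡c j j≢p j≢b with j ≟ q
      ... | yes refl = trans (unset-at q c₁′) (sym cq)
      ... | no j≢q = trans (unset-off c₁′ j≢q) (trans (c₁′≡c₁ j j≢q j≢b) (sym (c≡c₁ j≢p)))

    last : q < p → p ≡ b → Simulates A A′ (suc a) b c ℓ
    last q<p refl =
      conclude q A₀′ c₁′q (trans (proj₁ slid) (proj₁ exchange))
        (complete z≤n A₀p c′≗c λ j → trans (proj₂ slid j)
          (trans (proj₂ exchange j) (proj₂ (row-zeros (proj₂ (row (unit q) nothing u′))) j)))
      where
      open Pivotal q<p Finₚ.≤-refl

      exchange : Exchange (dipole q b) (unit b) (unit q) zeros nothing nothing nothing nothing u′
      exchange = exchange-last-pivot q b u′ q<b u′b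

      c′≗c : unset q c₁′ ≗ c
      c′≗c j with j ≟ q | j ≟ b
      ... | yes refl | _ = trans (unset-at q c₁′) (sym cq)
      ... | no j≢q | yes refl = trans (unset-off c₁′ j≢q) (trans c₁′b (sym cp))
      ... | no j≢q | no j≢b = trans (unset-off c₁′ j≢q) (trans (c₁′≡c₁ j j≢q j≢b) (sym (c≡c₁ j≢b)))

    by-position : Tri (p < q) (p ≡ q) (q < p) → Tri (p < b) (p ≡ b) (b < p) → Simulates A A′ (suc a) b c ℓ
    by-position (tri≈ _ p≡q _) _ = ⊥-elim (q≢p (sym p≡q))
    by-position (tri< p<q _ _) _ =
      outside (blocked i≤a Aiq (ℕₚ.<⇒≤ p<q) q≤b) (Finₚ.<⇒≢ (ℕₚ.<-≤-trans p<q q≤b))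
        λ j q≤j _ e → Finₚ.<⇒≢ (ℕₚ.<-≤-trans p<q q≤j) (sym e)
    by-position (tri> _ _ q<p) (tri< p<b _ _) = inside q<p p<b
    by-position (tri> _ _ q<p) (tri≈ _ p≡b _) = last q<p p≡b
    by-position (tri> _ _ q<p) (tri> _ _ b<p) =
      outside (λ P → ℕₚ.<⇒≱ b<p (proj₁ (proj₂ (proj₂ P)))) (Finₚ.<⇒≢ b<p ∘ sym)
        λ j _ j≤b e → Finₚ.<⇒≢ (ℕₚ.≤-<-trans j≤b b<p) e

-- Top rows are removed until row a is on top. Each of them lies above the first -1 and hence holds
-- a single 1.
simulates : {A A′ : Fin k → Vector Entry m} {a : Fin k} {b : Fin m} {c : Fin m → Bool} {ℓ : Vector (Label n) m} →
  (∀ j → is-just (ℓ j) ≡ true) → Grid c A → First-negative A a b → Inflates A a b A′ → Simulates A A′ a b c ℓ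
simulates {a = zero} ℓ-defined g F I = simulates-base g F I
simulates {a = suc a} ℓ-defined g (Aab , above , before) I
  with p , A₀ ← nonnegative⇒unit (row-run g zero) (λ j → above zero j z<s)
  with c₁ , s , g₁ ← grid-tail g
  with c₁′ , g₁′ , es , R ← simulates ℓ-defined g₁ (Aab , (λ i j i<a → above (suc i) j (s≤s i<a)) , before) (inflates-tail I)
  = simulates-step ℓ-defined g {p} A₀ Aab I s g₁′ es R

-- One inflation step on a square matrix

no-pipes : Fin m → Bool
no-pipes _ = false

inflate-inflates : (A : Matrix n) (a b : Fin n) (r : Removable A a b) → Inflates A a b (inflate A a b r)
inflate-inflates A a b r = record
  { corner = λ {i} {j} C → corner′ i j C
  ; erased = λ {i} {j} → erased′ i j
  ; kept   = λ {i} {j} → kept′ i j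
  }
  where
  corner′ : ∀ i j → Corner A a b i j → inflate A a b r i j ≡ 𝟏
  corner′ i j C rewrite dec-true (isCorner? A a b i j) C = refl

  erased′ : ∀ i j → ¬ Corner A a b i j → (i , j) ≡ (a , b) ⊎ Pivot A a b i j → inflate A a b r i j ≡ 𝟎
  erased′ i j ¬C e rewrite dec-false (isCorner? A a b i j) ¬C
    | dec-true ((i , j) ≟₂ (a , b) ⊎-dec isPivot? A a b i j) e = refl

  kept′ : ∀ i j → ¬ Corner A a b i j → (i , j) ≢ (a , b) → ¬ Pivot A a b i j → inflate A a b r i j ≡ A i j
  kept′ i j ¬C ne ¬P rewrite dec-false (isCorner? A a b i j) ¬C
    | dec-false ((i , j) ≟₂ (a , b) ⊎-dec isPivot? A a b i j) (λ { (inj₁ e) → ne e ; (inj₂ P) → ¬P P }) = refl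

inflate-preserves : (A : Matrix n) (a b : Fin n) → Grid no-pipes A → FirstNegative A a b → (r : Removable A a b) →
  Grid no-pipes (inflate A a b r) × proj₁ (rows A just) ≗ proj₁ (rows (inflate A a b r) just)
inflate-preserves A a b g F r with simulates (λ _ → refl) g F (inflate-inflates A a b r)
-- A pending relation would need a pipe across the top boundary in column b.
... | _ , _  , _  , pending _ _ _ _ () _ _ _ _ _
... | _ , g′ , es , complete _ _ c′≗c _ =
  record { row-run = row-run g′ ; column-run = λ j → subst (λ x → Run x _) (c′≗c j) (column-run g′ j) } , es

-- Exit labels of permutation matrices and of the key

row-passes : (x : Fin n) (b : Vector (Label n) m) → (∀ j → cross (just x) (b j) ≡ (just x , b j)) →
             row zeros (just x) b ≈ (just x , b)
row-passes {m = zero}  x b pass = refl , λ _ → refl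
row-passes {m = suc m} x b pass rewrite pass zero
  with e , u ← row-passes x (b ∘ suc) (pass ∘ suc) = e , λ { zero → refl ; (suc j) → u j }

row-unit : (p : Fin m) {x : Fin n} (b : Vector (Label n) m) → b p ≡ just x →
  (∀ j → p < j → cross (just x) (b j) ≡ (just x , b j)) →
  row (unit p) nothing b ≈ (just x , λ j → if does (p ≟ j) then nothing else b j)
row-unit zero {x} b bp pass rewrite bp
  with e , u ← row-passes x (b ∘ suc) (λ j → pass (suc j) z<s) = e , λ { zero → refl ; (suc j) → u j }
row-unit (suc p) b bp pass
  with e , u ← row-unit p (b ∘ suc) bp (λ j p<j → pass (suc j) (s<s p<j)) = e , λ { zero → refl ; (suc j) → u j }

-- The labels on a horizontal line when every pipe is still in its own column.
straight : (Fin n → Bool) → Vector (Label n) n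
straight c j = if c j then just j else nothing

rows-nonnegative : {A : Fin k → Vector Entry n} {c : Fin n → Bool} → Grid c A → (∀ i j → A i j ≢ -𝟏) →
  (∀ i → ∃ λ p → A i ≗ unit p × proj₁ (rows A just) i ≡ just p) × proj₂ (rows A just) ≗ straight c
rows-nonnegative {k = zero} g A≢-𝟏 =
  (λ ()) , λ j → cong (if_then just j else nothing) (sym (nil-run (column-run g j)))
rows-nonnegative {k = suc k} {A = A} {c} g A≢-𝟏
  with c₁ , s , g₁ ← grid-tail g
  with ps , u≗ ← rows-nonnegative g₁ (A≢-𝟏 ∘ suc)
  with p , A₀ ← nonnegative⇒unit (row-run g zero) (A≢-𝟏 zero)
  with c₁p ← proj₂ (step-𝟏 (trans (A₀ p) (unit-at p)) (s p))
  with e , w ← row-cong {l = nothing} A₀ refl u≗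
  = (λ { zero → p , A₀ , trans e (proj₁ top-row) ; (suc i) → ps i }) , λ j → trans (w j) (trans (proj₂ top-row j) (on-top j))
  where
  -- The pipe turning right in column p meets only pipes in columns j > p, and these carry the label
  -- j.
  pass : ∀ j → p < j → cross (just p) (straight c₁ j) ≡ (just p , straight c₁ j)
  pass j p<j with c₁ j
  ... | true  = cross-≤ (ℕₚ.<⇒≤ p<j)
  ... | false = refl

  top-row = row-unit p (straight c₁) (cong (if_then just p else nothing) c₁p) pass

  on-top : ∀ j → (if does (p ≟ j) then nothing else straight c₁ j) ≡ straight c j
  on-top j with p ≟ j
  ... | yes refl rewrite proj₁ (step-𝟏 (trans (A₀ p) (unit-at p)) (s p)) = refl
  ... | no p≢j = cong (if_then just j else nothing) (sym (step-𝟎 (trans (A₀ j) (unit-off (p≢j ∘ sym))) (s j)))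

-- The induction follows the recursion of `inflate-all`; exit labels are constant along it and are
-- read off from the permutation matrix at the end.
inflate-all-exits : (A : Matrix n) (wf : Acc ℕ._<_ (negatives A)) → Grid no-pipes A →
  ∀ i → ∃ λ p → inflate-all A wf i ≗ unit p × proj₁ (rows A just) i ≡ just p
inflate-all-exits A (acc rec) g i with first-negative A
... | inj₁ A≢-𝟏 = proj₁ (rows-nonnegative g A≢-𝟏) i
... | inj₂ (a , b , F)
  with g′ , es ← inflate-preserves A a b g F (first-removable A a b F)
  with p , M , e ← inflate-all-exits (inflate A a b (first-removable A a b F)) (rec _) g′ i
  = p , M , trans (es i) e

asm-grid : (A : ASM n) → Grid no-pipes (matrix A)
asm-grid A = record
  { row-run    = λ i → run (matrix A i) (ASM.row-alternates A i) (ASM.row-sum A i)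
  ; column-run = λ j → run (λ i → matrix A i j) (ASM.col-alternates A j) (ASM.col-sum A j) }

theorem4p3 : (n : ℕ) (A : ASM n) (i j : Fin n) →
    permutationMatrix (∂ (Φ A)) i j ≡ κ A i j
theorem4p3 n A i j
  with p , κᵢ , e ← inflate-all-exits (matrix A) (<-wellFounded _) (asm-grid A) i
  -- `permutationMatrix` has the rows `unit (w ⟨$⟩ʳ i)` by definition.
  = trans (cong (λ q → unit q j) ∂i≡p) (sym (κᵢ j))
  where
  ∂i≡p : ∂ (Φ A) ⟨$⟩ʳ i ≡ p
  ∂i≡p = just-injective (trans (sym (∂-exit-label (Φ A) i)) (trans (exit-label-Φ A i) e))
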